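{- Let $q$ be an integer with $q\geq2$ and let $p\in\{ -1,1\}$. Let $\tau$ be a root of $X^2-pX+q$, let $w\geq2$ be an integer and let $\mathcal{D}$ be the minimal norm representative digit set modulo $\tau^w$. Then there exists an effectively computable bound $w_q$ such that for all $w\geq w_q$ the width-$w$ non-adjacent form expansion is not optimal with respect to $\tau$ and $\mathcal{D}$. In particular, one may choose $w_q=8.68\cdot 10^{15}\log q\log\log q$ if $q\geq13$, and $w_q=1.973\cdot10^{16}$ if $q\in\{2,3,\dots,12\}$.
   Context: $\mathbb{Z}[\tau]=\{a+b\tau: a,b\in\mathbb{Z}\}$. The minimal norm representative digit set modulo $\tau^w$ is the set $\mathcal{D}\subseteq\mathbb{Z}[\tau]$ consisting of $0$ together with, for each residue class of $\mathbb{Z}[\tau]$ modulo $\tau^w$ whose elements are not divisible by $\tau$, a representative of minimal absolute value (equivalently, a representative lying in $\tau^w V$, where $V=\{z\in\mathbb{C}: |z|\le|z-y| \text{ for all } y\in\mathbb{Z}[\tau]\}$ is the Voronoi cell of $0$). A digit expansion of $z$ is a finite sum $z=\sum_{\ell=0}^{L-1}\sigma_\ell\tau^\ell$ with $\sigma_\ell\in\mathcal{D}$. It is a width-$w$ non-adjacent form ($w$-NAF) if every block $\sigma_\ell\sigma_{\ell+1}\cdots\sigma_{\ell+w-1}$ ($0\le\ell\le L-w$) contains at most one nonzero digit. The weight of an expansion is its number of nonzero digits; an expansion of $z$ is optimal if no expansion of $z$ with digits in $\mathcal{D}$ has smaller weight. The $w$-NAF expansion is called optimal (with respect to $\tau$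 and $\mathcal{D}$) if the $w$-NAF of every element of $\mathbb{Z}[\tau]$ is optimal. (Every element of $\mathbb{Z}[\tau]$ has a unique $w$-NAF expansion.) -}

module Defs where

open import Data.Nat as ℕ using (ℕ; zero; suc)
open import Data.Integer as ℤ using (ℤ; +_)
open import Data.Product using (Σ; ∃; _×_; _,_)
open import Data.Sum using (_⊎_)
open import Data.List using (List; []; _∷_; length; lookup)
open import Data.Fin using (Fin; toℕ)
open import Relation.Binary.PropositionalEquality using (_≡_; _≢_)
open import Relation.Nullary using (¬_; yes; no)
open import Data.Empty using (⊥)
open import Data.Rational.Unnormalised as ℚ using (ℚᵘ)

-- The ring ℤ[τ], τ a root of X² - pX + q.  Elements a + bτ are pairs (a , b).
-- Arithmetic only depends on (p , q):  τ² = pτ - q.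

Zτ : Set
Zτ = ℤ × ℤ

zeroτ : Zτ
zeroτ = (+ 0 , + 0)

oneτ : Zτ
oneτ = (+ 1 , + 0)

tauτ : Zτ
tauτ = (+ 0 , + 1)

addτ : Zτ → Zτ → Zτ
addτ (a , b) (c , d) = (a ℤ.+ c , b ℤ.+ d)

negτ : Zτ → Zτ
negτ (a , b) = (ℤ.- a , ℤ.- b)

subτ : Zτ → Zτ → Zτ
subτ x y = addτ x (negτ y)

mulτ : (p q : ℤ) → Zτ → Zτ → Zτ
mulτ p q (a , b) (c , d) =
  (a ℤ.* c ℤ.- q ℤ.* (b ℤ.* d) , a ℤ.* d ℤ.+ b ℤ.* c ℤ.+ p ℤ.* (b ℤ.* d))

powτ : (p q : ℤ) → Zτ → ℕ → Zτ
powτ p q x zero    = oneτ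
powτ p q x (suc n) = mulτ p q x (powτ p q x n)

-- |a + bτ|² = (a + bτ)(a + bτ̄) = a² + p a b + q b²   (τ + τ̄ = p, ττ̄ = q)
normτ : (p q : ℤ) → Zτ → ℤ
normτ p q (a , b) = a ℤ.* a ℤ.+ p ℤ.* (a ℤ.* b) ℤ.+ q ℤ.* (b ℤ.* b)

Dividesτ : (p q : ℤ) → Zτ → Zτ → Set
Dividesτ p q x y = Σ Zτ λ k → y ≡ mulτ p q x k

CongMod : (p q : ℤ) (w : ℕ) → Zτ → Zτ → Set
CongMod p q w x y = Dividesτ p q (powτ p q tauτ w) (subτ x y)

record IsMinNormDigitSet (p q : ℤ) (w : ℕ) (D : Zτ → Set) : Set where
  field
    zero∈D      : D zeroτ
    nonzero-ok  : ∀ d → D d → d ≡ zeroτ ⊎ ¬ Dividesτ p q tauτ d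
    represent   : ∀ z → ¬ Dividesτ p q tauτ z →
                  Σ Zτ λ d → D d × CongMod p q w d z
                    × (∀ y → CongMod p q w y z → normτ p q d ℤ.≤ normτ p q y)
    unique-rep  : ∀ d d′ → D d → D d′ → CongMod p q w d d′ → d ≡ d′

-- Digit expansions: list of digits σ₀ σ₁ … σ_{L-1} (least significant first).

value : (p q : ℤ) → List Zτ → Zτ
value p q []      = zeroτ
value p q (σ ∷ s) = addτ σ (mulτ p q tauτ (value p q s))

isZeroτ : Zτ → Set
isZeroτ x = x ≡ zeroτ

weight : List Zτ → ℕ
weight [] = 0
weight ((a , b) ∷ s) with a ℤ.≟ + 0 | b ℤ.≟ + 0
... | yes _ | yes _ = weight s
... | _     | _     = suc (weight s)

AllIn : (D : Zτ → Set) → List Zτ → Set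
AllIn D s = ∀ (i : Fin (length s)) → D (lookup s i)

-- width-w non-adjacent form: any two distinct positions i < j carrying
-- nonzero digits satisfy j - i ≥ w (i.e. every block of w consecutive digits,
-- the expansion being padded with zeros, has at most one nonzero digit).
IsWNAF : (w : ℕ) → List Zτ → Set
IsWNAF w s = ∀ (i j : Fin (length s)) → toℕ i ℕ.< toℕ j → toℕ j ℕ.< toℕ i ℕ.+ w →
             lookup s i ≢ zeroτ → lookup s j ≢ zeroτ → ⊥

WNAFOptimal : (p q : ℤ) (w : ℕ) (D : Zτ → Set) → Set
WNAFOptimal p q w D =
  ∀ (s t : List Zτ) → AllIn D s → IsWNAF w s → AllIn D t →
  value p q s ≡ value p q t → weight s ℕ.≤ weight t

expTerm : ℚᵘ → ℕ → ℚᵘ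
expTerm x zero    = ℚ.1ℚᵘ
expTerm x (suc k) = expTerm x k ℚ.* x ℚ.* (+ 1 ℚ./ suc k)

expPartial : ℚᵘ → ℕ → ℚᵘ
expPartial x zero    = ℚ.1ℚᵘ
expPartial x (suc n) = expPartial x n ℚ.+ expTerm x (suc n)

-- For rational x > 0 and rational y:  e^x < y.
-- (The partial sums increase strictly to e^x.)
ExpLt : ℚᵘ → ℚᵘ → Set
ExpLt x y = Σ ℚᵘ λ ε → ℚ.0ℚᵘ ℚ.< ε × (∀ n → expPartial x n ℚ.+ ε ℚ.≤ y)

-- The real inequality  C · log q · log log q ≤ W  (q ≥ 3, C > 0 rational, W ≥ 0),
-- expressed as: for all rationals a, b > 0 with a < log q and b < log a,
-- C·a·b ≤ W.  (The supremum of a·b over such a, b is log q · log log q.)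
LogLogBound : (C : ℚᵘ) (q : ℕ) (W : ℚᵘ) → Set
LogLogBound C q W =
  ∀ (a b : ℚᵘ) → ℚ.0ℚᵘ ℚ.< a → ℚ.0ℚᵘ ℚ.< b →
  ExpLt a (+ q ℚ./ 1) → ExpLt b a → C ℚ.* (a ℚ.* b) ℚ.≤ W

WNAFNotOptimal : (p q : ℤ) (w : ℕ) → Set₁
WNAFNotOptimal p q w = ∀ (D : Zτ → Set) → IsMinNormDigitSet p q w D → ¬ WNAFOptimal p q w D

C-large : ℚᵘ
C-large = + 868000000000000000 ℚ./ 100

{-# OPTIONS --safe #-}

-- Put ω₁ = τ^(w-1) and ω = τω₁, and let V be the Voronoi cell of 0 in ℤ[τ].  Since the trace of τ
-- is ±1, a facet of V lies on a facet of τV.  Hence there is a point r slightly outside ωV, close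
-- to the midpoint ω/2 of a facet, such that τr is moved into the interior of ωV by subtracting a
-- small e.  Choose digits d₁ and c with d₁ - c = eω₁.  With d₂ = τr - e,
--   d₁ + ω₁d₂ = c + ωr = c + ω(r - ω) + ω²,
-- where d₂ and r - ω are digits: an expansion of weight 2 against a w-NAF of weight 3.
--
-- The point r is ω/2 plus a half-integral point depending on q and on τ^(w-1) modulo 2.  Only if q
-- is odd and 3 divides w - 1 can this point be large; it is under control as soon as
-- |Tr τ^(w-1)| ≥ 32, which follows from Tr τ^(3k) = Tr τ^k ((Tr τ^k)² - 3q^k).  No linear forms in
-- logarithms are needed, and w ≥ 31 suffices for all q.
module Submission where

open import Defs

-- The integers `V = Tr ω` and `U = Tr (τ ω̄)` depend on the argument of `τ^w`, so no bound on their
-- ratio is available. Write `2r - ω = a + bτ`. Then `r` exceeds the facet by `η = aV + bU`,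
-- multiplication by `τ` turns this into `qη`, and `e` compensates it if `0 < qη < 2 Tr (e ω̄ τ̄)`.
-- The right side is again an integral combination of `V` and `U`, so three fixed values of `e`
-- suffice whatever the ratio is, chosen by the sign of `V` and by which of `U` and `|V|` has to
-- dominate. A tie would be fatal, but `q` divides `U` and not `V`. The obstacle is that `a` and `b`
-- are prescribed modulo 2 while `r` must not be divisible by `τ`. For `q` odd and `ω₁` congruent to
-- 1 modulo 2, this forbids `a = 0`; with `a = 2` or `a = -2` a large `|V|` has to be balanced by a
-- large `b`. The trace bound needs `q^k ≥ 2^10` where `w - 1 = 3k`, hence `w ≥ 31`; the other size
-- estimates hold from `w - 1 ≥ 18` on. The case `p = -1` reduces to `p = 1` because `pτ` is a root
-- of `X² - X + q`.

module NonOptimality where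

  open import Data.Fin using (Fin; toℕ; zero; suc)
  open import Data.Integer hiding (suc; _⊖_; _/_)
  open import Data.Integer.Divisibility.Signed
  open import Data.Integer.DivMod using (a≡a%ℕn+[a/ℕn]*n; _/ℕ_; _%ℕ_; n%ℕd<d)
  open import Data.Integer.Properties
  open import Data.Integer.Tactic.RingSolver using (ring; solve; solve-∀)
  open import Data.List using (List; []; _∷_; _++_; replicate; length; lookup)
  open import Data.Nat as ℕ using (ℕ; suc; zero; z≤n; s≤s)
  import Data.Nat.Divisibility as ℕ
  import Data.Nat.Properties as ℕ
  open import Data.Product using (Σ; _×_; _,_; proj₁; proj₂)
  open import Data.Sum using (_⊎_; inj₁; inj₂; [_,_]′)
  open import Function using (_∘_)
  open import Relation.Binary.Definitions using (tri<; tri≈; tri>)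
  open import Relation.Binary.PropositionalEquality
  open import Relation.Nullary using (¬_; Dec; yes; no; contradiction)
  open import Relation.Nullary.Decidable using (toSum)
  import Tactic.RingSolver.NonReflective ring as NR
  open NR using (Expr; Κ; _⊕_; _⊗_; ⊝_)

  -- Certificates for integer inequalities

  infixr 5 _⊞⁺_
  infixl 6 _⊞_
  infixl 7 _⊠_ _⊠⁺_
  infixr 8 _·_ _·⁺_

  _⊞_ : ∀ {x y} → 0ℤ ≤ x → 0ℤ ≤ y → 0ℤ ≤ x + y
  _⊞_ = +-mono-≤

  _⊞⁺_ : ∀ {x y} → 0ℤ < x → 0ℤ ≤ y → 0ℤ < x + y
  _⊞⁺_ = +-mono-<-≤

  _⊠_ : ∀ {x y} → 0ℤ ≤ x → 0ℤ ≤ y → 0ℤ ≤ x * y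
  _⊠_ {+ m} {+ n} _ _ = subst (0ℤ ≤_) (pos-* m n) (+≤+ z≤n)

  _⊠⁺_ : ∀ {x y} → 0ℤ < x → 0ℤ < y → 0ℤ < x * y
  _⊠⁺_ {+[1+ m ]} {+[1+ n ]} _ _ = +<+ (s≤s z≤n)
  _⊠⁺_ {+[1+ m ]} {+0} _ (+<+ ())
  _⊠⁺_ {+0} (+<+ ())

  _·_ : ∀ n {x} → 0ℤ ≤ x → 0ℤ ≤ + n * x
  _·_ n {x} h = _⊠_ {+ n} {x} (+≤+ z≤n) h

  _·⁺_ : ∀ n .{{_ : ℕ.NonZero n}} {x} → 0ℤ < x → 0ℤ < + n * x
  _·⁺_ (suc n) {x} h = _⊠⁺_ {+ suc n} {x} (+<+ (s≤s z≤n)) h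

  -- An inequality 0 ≤ y is proved by writing a multiple of y as a combination x of terms known to be
  -- nonnegative; the ring solver checks the identity.
  by≤ : ∀ k .{{_ : ℕ.NonZero k}} {x y} → 0ℤ ≤ x → x ≡ + k * y → 0ℤ ≤ y
  by≤ (suc k) {y = y} h refl = *-cancelˡ-≤-pos 0ℤ y (+ suc k) (subst (_≤ + suc k * y) (sym (*-zeroʳ (+ suc k))) h)

  by< : ∀ k .{{_ : ℕ.NonZero k}} {x y} → 0ℤ < x → x ≡ + k * y → 0ℤ < y
  by< (suc k) {y = y} h refl = *-cancelˡ-<-nonNeg (+ suc k) (subst (_< + suc k * y) (sym (*-zeroʳ (+ suc k))) h)

  cancel≤ : ∀ {k y} → 0ℤ < k → 0ℤ ≤ k * y → 0ℤ ≤ y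
  cancel≤ {+[1+ k ]} _ h = by≤ (suc k) h refl
  cancel≤ {+0} (+<+ ())

  0<1 : 0ℤ < + 1
  0<1 = +<+ (s≤s z≤n)

  square≥0 : ∀ x → 0ℤ ≤ x * x
  square≥0 x = subst (0ℤ ≤_) (trans (pos-* ∣ x ∣ ∣ x ∣) (lemma x)) (+≤+ z≤n)
    where
    lemma : ∀ x → + ∣ x ∣ * + ∣ x ∣ ≡ x * x
    lemma (+ n)    = refl
    lemma -[1+ n ] = refl

  -- Hexagons

  -- For A = Tr z and B = Tr (z τ̄) the inequalities |A| < 1, |B| < q and |B - A| < q describe the
  -- interior of the Voronoi cell of ℤ[τ], where τ² = τ - q.
  record Hexagon (_∼_ : ℤ → ℤ → Set) (l m A B : ℤ) : Set where
    constructor hexagon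
    field
      A≲ : 0ℤ ∼ (l - A)
      A≳ : 0ℤ ∼ (l + A)
      B≲ : 0ℤ ∼ (m - B)
      B≳ : 0ℤ ∼ (m + B)
      C≲ : 0ℤ ∼ (m - (B - A))
      C≳ : 0ℤ ∼ (m + (B - A))

  -- With `Q = |ω|²`, `A = Tr (z ω̄)` and `B = Tr (z ω̄ τ̄)` this is the open cell of `ωℤ[τ]`.
  Inside : (q Q A B : ℤ) → Set
  Inside q Q = Hexagon _<_ Q (q * Q)

  -- Points are located relative to `ω/2` and `eω₁/2`, so the estimates are made for doubled traces,
  -- which stay integral.
  Inside-half : ∀ q Q A B {X Y} → Inside q (+ 2 * Q) X Y → X ≡ + 2 * A → Y ≡ + 2 * B → Inside q Q A B
  Inside-half q Q A B (hexagon a a′ b b′ c c′) refl refl = hexagon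
    (by< 2 a (solve (q ∷ Q ∷ A ∷ B ∷ []))) (by< 2 a′ (solve (q ∷ Q ∷ A ∷ B ∷ [])))
    (by< 2 b (solve (q ∷ Q ∷ A ∷ B ∷ []))) (by< 2 b′ (solve (q ∷ Q ∷ A ∷ B ∷ [])))
    (by< 2 c (solve (q ∷ Q ∷ A ∷ B ∷ []))) (by< 2 c′ (solve (q ∷ Q ∷ A ∷ B ∷ [])))

  Inside-neg : ∀ q Q A B {X Y} → Inside q Q A B → X ≡ - A → Y ≡ - B → Inside q Q X Y
  Inside-neg q Q A B (hexagon a a′ b b′ c c′) refl refl = hexagon
    (by< 1 a′ (solve (q ∷ Q ∷ A ∷ B ∷ []))) (by< 1 a (solve (q ∷ Q ∷ A ∷ B ∷ [])))
    (by< 1 b′ (solve (q ∷ Q ∷ A ∷ B ∷ []))) (by< 1 b (solve (q ∷ Q ∷ A ∷ B ∷ [])))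
    (by< 1 c′ (solve (q ∷ Q ∷ A ∷ B ∷ []))) (by< 1 c (solve (q ∷ Q ∷ A ∷ B ∷ [])))

  Hexagon-neg : ∀ l m A B → Hexagon _≤_ l m A B → Hexagon _≤_ l m (- A) (- B)
  Hexagon-neg l m A B (hexagon a a′ b b′ c c′) = hexagon
    (by≤ 1 a′ (solve (l ∷ m ∷ A ∷ B ∷ []))) (by≤ 1 a (solve (l ∷ m ∷ A ∷ B ∷ [])))
    (by≤ 1 b′ (solve (l ∷ m ∷ A ∷ B ∷ []))) (by≤ 1 b (solve (l ∷ m ∷ A ∷ B ∷ [])))
    (by≤ 1 c′ (solve (l ∷ m ∷ A ∷ B ∷ []))) (by≤ 1 c (solve (l ∷ m ∷ A ∷ B ∷ [])))

  Hexagon-scale : ∀ P l m A B {l′ m′ A′ B′} → 0ℤ ≤ P → Hexagon _≤_ l m A B →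
    l′ ≡ P * l → m′ ≡ P * m → A′ ≡ P * A → B′ ≡ P * B → Hexagon _≤_ l′ m′ A′ B′
  Hexagon-scale P l m A B h (hexagon a a′ b b′ c c′) refl refl refl refl = hexagon
    (by≤ 1 (h ⊠ a) (solve (P ∷ l ∷ m ∷ A ∷ B ∷ []))) (by≤ 1 (h ⊠ a′) (solve (P ∷ l ∷ m ∷ A ∷ B ∷ [])))
    (by≤ 1 (h ⊠ b) (solve (P ∷ l ∷ m ∷ A ∷ B ∷ []))) (by≤ 1 (h ⊠ b′) (solve (P ∷ l ∷ m ∷ A ∷ B ∷ [])))
    (by≤ 1 (h ⊠ c) (solve (P ∷ l ∷ m ∷ A ∷ B ∷ []))) (by≤ 1 (h ⊠ c′) (solve (P ∷ l ∷ m ∷ A ∷ B ∷ [])))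

  -- Triangle inequality: rounding a half-integral point costs less than `P`, which is the margin
  -- that `Carry.wide` leaves after scaling by `P`.
  Hexagon-+ : ∀ l m P A B X Y → Hexagon _<_ P P X Y → Hexagon _≤_ (l - P) (m - P) A B →
    Hexagon _<_ l m (A + X) (B + Y)
  Hexagon-+ l m P A B X Y (hexagon a a′ b b′ c c′) (hexagon d d′ e e′ f f′) = hexagon
    (by< 1 (a ⊞⁺ d) (solve (l ∷ m ∷ P ∷ A ∷ B ∷ X ∷ Y ∷ []))) (by< 1 (a′ ⊞⁺ d′) (solve (l ∷ m ∷ P ∷ A ∷ B ∷ X ∷ Y ∷ [])))
    (by< 1 (b ⊞⁺ e) (solve (l ∷ m ∷ P ∷ A ∷ B ∷ X ∷ Y ∷ []))) (by< 1 (b′ ⊞⁺ e′) (solve (l ∷ m ∷ P ∷ A ∷ B ∷ X ∷ Y ∷ [])))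
    (by< 1 (c ⊞⁺ f) (solve (l ∷ m ∷ P ∷ A ∷ B ∷ X ∷ Y ∷ []))) (by< 1 (c′ ⊞⁺ f′) (solve (l ∷ m ∷ P ∷ A ∷ B ∷ X ∷ Y ∷ [])))

  -- ∣X∣ ≤ P / n
  record Small (n : ℕ) (P X : ℤ) : Set where
    constructor small
    field
      ≲ : 0ℤ ≤ P - + n * X
      ≳ : 0ℤ ≤ P + + n * X

  Small-neg : ∀ {n P X Y} → Small n P X → Y ≡ - X → Small n P Y
  Small-neg {n} {P} {X} (small h h′) refl = small
    (subst (λ z → 0ℤ ≤ P + z) (trans (sym (neg-involutive _)) (cong -_ (neg-distribʳ-* (+ n) X))) h′)
    (subst (λ z → 0ℤ ≤ P + z) (neg-distribʳ-* (+ n) X) h)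

  Small-* : ∀ P ε X → 0ℤ ≤ ε + + 2 → 0ℤ ≤ + 2 - ε → Small 64 P X → Small 32 P (ε * X)
  Small-* P ε X h h′ (small x x′) = small
    -- Interpolation between the two bounds: `(ε + 2)(P - 64X) + (2 - ε)(P + 64X) = 4(P - 32εX)`.
    (by≤ 4 (h ⊠ x ⊞ h′ ⊠ x′) (solve (P ∷ ε ∷ X ∷ [])))
    (by≤ 4 (h ⊠ x′ ⊞ h′ ⊠ x) (solve (P ∷ ε ∷ X ∷ [])))

  -- For r close to ω/2: η = 2 Tr (r ω̄) - 2Q and ζ = 2 Tr (r ω̄ τ̄) - Q, where Q = |ω|².
  module Perturbation
    (q Q η ζ Ae Be : ℤ) (q≥2 : 0ℤ ≤ q - + 2) (Q>0 : 0ℤ < Q) (η>0 : 0ℤ < η)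
    -- `Tr (τr ω̄ τ̄)` is `q` times `Tr (r ω̄)`, so the doubled excess `η` of `r` becomes `qη` for
    -- `τr`; subtracting `e` has to make it negative.
    (facet : 0ℤ < + 2 * Be - q * η)
    (smallζ : Small 2 Q ζ) (smallA : Small 16 Q Ae) (smallB : Small 16 Q Be)
    where

    open Small

    private
      Q≥0 = <⇒≤ Q>0
      η≥0 = <⇒≤ η>0
      z1 = ≲ smallζ
      z2 = ≳ smallζ
      a1 = ≲ smallA
      a2 = ≳ smallA
      b1 = ≲ smallB
      qQ = q≥2 ⊠ Q≥0
      qη = q≥2 ⊠ η≥0
      k = <⇒≤ facet

    -- These are the doubled traces of `r - ω`, a point near `-ω/2`. The close facet is respected
    -- because `η > 0`; for the opposite one, `2η ≤ qη < 2Be` shows that `η` is small against `Q`.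
    Inside-quotient : Inside q (+ 2 * Q) (η - + 2 * Q) (ζ - Q)
    Inside-quotient = hexagon
      (by< 16 (31 ·⁺ Q>0 ⊞⁺ 8 · k ⊞ 8 · qη ⊞ b1 ⊞ 32 · Q≥0) (solve (q ∷ Q ∷ η ∷ ζ ∷ Be ∷ [])))
      (by< 1 η>0 (solve (q ∷ Q ∷ η ∷ ζ ∷ [])))
      (by< 2 (9 ·⁺ Q>0 ⊞⁺ z1 ⊞ 4 · qQ) (solve (q ∷ Q ∷ η ∷ ζ ∷ [])))
      (by< 2 (5 ·⁺ Q>0 ⊞⁺ z2 ⊞ 4 · qQ) (solve (q ∷ Q ∷ η ∷ ζ ∷ [])))
      (by< 2 (5 ·⁺ Q>0 ⊞⁺ z1 ⊞ 2 · η≥0 ⊞ 4 · qQ) (solve (q ∷ Q ∷ η ∷ ζ ∷ [])))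
      (by< 16 (71 ·⁺ Q>0 ⊞⁺ 8 · z2 ⊞ 8 · k ⊞ 8 · qη ⊞ b1 ⊞ 32 · qQ) (solve (q ∷ Q ∷ η ∷ ζ ∷ Be ∷ [])))

    -- These are the doubled traces of `τr - e`: since `τ = 1 - τ̄`, `Tr (τr ω̄)` is
    -- `Tr (r ω̄) - Tr (r ω̄ τ̄)`. The critical inequality is exactly `facet`.
    Inside-high-digit : Inside q (+ 2 * Q) (Q + η - ζ - + 2 * Ae) (+ 2 * q * Q + q * η - + 2 * Be)
    Inside-high-digit = hexagon
      (by< 16 (5 ·⁺ Q>0 ⊞⁺ 2 · a2 ⊞ 8 · z2 ⊞ 8 · k ⊞ 8 · qη ⊞ b1) (solve (q ∷ Q ∷ η ∷ ζ ∷ Ae ∷ Be ∷ [])))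
      (by< 8 (19 ·⁺ Q>0 ⊞⁺ a1 ⊞ 4 · z1 ⊞ 8 · η≥0) (solve (q ∷ Q ∷ η ∷ ζ ∷ Ae ∷ Be ∷ [])))
      (by< 1 facet (solve (q ∷ Q ∷ η ∷ ζ ∷ Ae ∷ Be ∷ [])))
      (by< 8 (63 ·⁺ Q>0 ⊞⁺ b1 ⊞ 8 · qη ⊞ 16 · η≥0 ⊞ 32 · qQ) (solve (q ∷ Q ∷ η ∷ ζ ∷ Ae ∷ Be ∷ [])))
      (by< 8 (3 ·⁺ Q>0 ⊞⁺ 8 · k ⊞ 8 · η≥0 ⊞ a1 ⊞ 4 · z1) (solve (q ∷ Q ∷ η ∷ ζ ∷ Ae ∷ Be ∷ [])))
      (by< 8 (50 ·⁺ Q>0 ⊞⁺ 8 · qη ⊞ 8 · η≥0 ⊞ b1 ⊞ a2 ⊞ 4 · z2 ⊞ 32 · qQ) (solve (q ∷ Q ∷ η ∷ ζ ∷ Ae ∷ Be ∷ [])))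

  module _ {n : ℕ} where

    0ᴱ 1ᴱ 2ᴱ -1ᴱ : Expr ℤ n
    0ᴱ = Κ (+ 0)
    1ᴱ = Κ (+ 1)
    2ᴱ = Κ (+ 2)
    -1ᴱ = Κ -1ℤ

    infixl 6 _⊖_

    _⊖_ : Expr ℤ n → Expr ℤ n → Expr ℤ n
    x ⊖ y = x ⊕ (⊝ y)

    -- Syntactic copies of the operations of Defs, so that the ring solver sees through them.
    mulᴱ : (p q : Expr ℤ n) (x y : Expr ℤ n × Expr ℤ n) → Expr ℤ n × Expr ℤ n
    mulᴱ p q (a , b) (c , d) = a ⊗ c ⊖ q ⊗ (b ⊗ d) , a ⊗ d ⊕ b ⊗ c ⊕ p ⊗ (b ⊗ d)

    addᴱ subᴱ : (x y : Expr ℤ n × Expr ℤ n) → Expr ℤ n × Expr ℤ n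
    addᴱ (a , b) (c , d) = a ⊕ c , b ⊕ d
    subᴱ (a , b) (c , d) = a ⊖ c , b ⊖ d

    normᴱ : (p q : Expr ℤ n) (x : Expr ℤ n × Expr ℤ n) → Expr ℤ n
    normᴱ p q (a , b) = a ⊗ a ⊕ p ⊗ (a ⊗ b) ⊕ q ⊗ (b ⊗ b)

    tauᴱ : Expr ℤ n × Expr ℤ n
    tauᴱ = 0ᴱ , 1ᴱ

  -- The carry

  -- For ω₁ = f + gτ with τ² = τ - q and ω = τω₁:
  -- V q f g = Tr ω,  U q f g = Tr (τω̄),  lineA q f g z = Tr (z ω̄),  lineB q f g z = Tr (z ω̄ τ̄).
  V U : (q f g : ℤ) → ℤ
  V q f g = f + (+ 1 - + 2 * q) * g
  U q f g = q * (+ 2 * f + g)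

  lineA lineB : (q f g : ℤ) → Zτ → ℤ
  lineA q f g (a , b) = a * V q f g + b * U q f g
  lineB q f g (a , b) = a * (V q f g - U q f g) + b * (q * V q f g)

  module _ {n : ℕ} where

    Vᴱ Uᴱ : (q f g : Expr ℤ n) → Expr ℤ n
    Vᴱ q f g = f ⊕ (1ᴱ ⊖ 2ᴱ ⊗ q) ⊗ g
    Uᴱ q f g = q ⊗ (2ᴱ ⊗ f ⊕ g)

    lineAᴱ lineBᴱ : (q f g : Expr ℤ n) → Expr ℤ n × Expr ℤ n → Expr ℤ n
    lineAᴱ q f g (a , b) = a ⊗ Vᴱ q f g ⊕ b ⊗ Uᴱ q f g
    lineBᴱ q f g (a , b) = a ⊗ (Vᴱ q f g ⊖ Uᴱ q f g) ⊕ b ⊗ (q ⊗ Vᴱ q f g)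

  N₁ : (q f g : ℤ) → ℤ
  N₁ q f g = normτ (+ 1) q (f , g)

  -- z lies in the interior of the Voronoi cell of ωℤ[τ] and is not divisible by τ.
  record Good (q f g : ℤ) (z : Zτ) : Set where
    constructor good
    field
      inside : Inside q (q * N₁ q f g) (lineA q f g z) (lineB q f g z)
      τ∤     : ¬ q ∣ proj₁ z

  -- The field `r` is the digit `r - ω` of the w-NAF; the summand `ω` in `carry` comes from its
  -- leading digit 1.
  record Core (q f g : ℤ) : Set where
    field
      d₁ d₂ c r : Zτ
      good-d₁ : Good q f g d₁
      good-d₂ : Good q f g d₂
      good-c  : Good q f g c
      good-r  : Good q f g r
      carry   : let ω = mulτ (+ 1) q tauτ (f , g) in
                addτ d₁ (mulτ (+ 1) q (f , g) d₂) ≡ addτ c (mulτ (+ 1) q ω (addτ r ω))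

  -- Rounding halves to integers that `q` does not divide

  ∤1 : ∀ {q} → 0ℤ ≤ q - + 2 → ¬ q ∣ + 1
  ∤1 {+ 0} ()
  ∤1 {+ 1} ()
  ∤1 {+ suc (suc n)} _ h with ℕ.∣1⇒≡1 (∣⇒∣ᵤ h)
  ... | ()
  ∤1 { -[1+ n ]} ()

  floor-half : ∀ E → Σ ℤ λ k → E ≡ + 2 * k ⊎ E ≡ + 1 + + 2 * k
  floor-half E with a≡a%ℕn+[a/ℕn]*n E 2 | n%ℕd<d E 2
  ... | eq | lt with E %ℕ 2
  ... | 0 = E /ℕ 2 , inj₁ (trans eq (trans (+-identityˡ _) (*-comm (E /ℕ 2) (+ 2))))
  ... | 1 = E /ℕ 2 , inj₂ (trans eq (cong (λ z → + 1 + z) (*-comm (E /ℕ 2) (+ 2))))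
  floor-half E | _ | s≤s (s≤s ()) | suc (suc _)

  0≤+ : ∀ n → 0ℤ ≤ + n
  0≤+ n = +≤+ z≤n

  floor-half-bounds : ∀ E → Σ ℤ λ k → 0ℤ ≤ E - + 2 * k × 0ℤ ≤ + 1 - (E - + 2 * k)
  floor-half-bounds E with floor-half E
  ... | k , eq = k , [ even E k , odd E k ]′ eq
    where
    even : ∀ E k → E ≡ + 2 * k → 0ℤ ≤ E - + 2 * k × 0ℤ ≤ + 1 - (E - + 2 * k)
    even _ k refl = by≤ 1 (0≤+ 0) (solve (k ∷ [])) , by≤ 1 (0≤+ 1) (solve (k ∷ []))
    odd : ∀ E k → E ≡ + 1 + + 2 * k → 0ℤ ≤ E - + 2 * k × 0ℤ ≤ + 1 - (E - + 2 * k)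
    odd _ k refl = by≤ 1 (0≤+ 1) (solve (k ∷ [])) , by≤ 1 (0≤+ 0) (solve (k ∷ []))

  IndivisibleHalf : (q E : ℤ) → Set
  IndivisibleHalf q E = Σ ℤ λ d → ¬ q ∣ d × 0ℤ ≤ + 2 * d - E + + 2 × 0ℤ ≤ + 2 - (+ 2 * d - E)

  -- Of the consecutive integers `k` and `k + 1`, where `k` is the floor of `E/2`, at most one is
  -- divisible by `q ≥ 2`.
  half-indivisible : ∀ q E → 0ℤ ≤ q - + 2 → IndivisibleHalf q E
  half-indivisible q E q≥2 = choose (floor-half-bounds E)
    where
    choose : (Σ ℤ λ k → 0ℤ ≤ E - + 2 * k × 0ℤ ≤ + 1 - (E - + 2 * k)) → IndivisibleHalf q E
    choose (k , h , h′) = [ above , below ]′ (toSum (q ∣? k))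
      where
      below : ¬ q ∣ k → IndivisibleHalf q E
      below ¬p = k , ¬p , by≤ 1 (0≤+ 1 ⊞ h′) (solve (k ∷ E ∷ [])) , by≤ 1 (0≤+ 2 ⊞ h) (solve (k ∷ E ∷ []))
      above : q ∣ k → IndivisibleHalf q E
      above p = k + + 1 , (λ h → ∤1 q≥2 (∣m+n∣m⇒∣n h p))
              , by≤ 1 (0≤+ 3 ⊞ h′) (solve (k ∷ E ∷ [])) , by≤ 1 h (solve (k ∷ E ∷ []))

  half : ∀ E → Σ ℤ λ d → 0ℤ ≤ + 2 * d - E + + 2 × 0ℤ ≤ + 2 - (+ 2 * d - E)
  half E with half-indivisible (+ 2) E (0≤+ 0)
  ... | d , _ , h , h′ = d , h , h′

  -- The properties of ω₁ = ±τ^(w-1), w large, that the construction uses.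
  record Reduced (q f g : ℤ) : Set where
    field
      q≥2  : 0ℤ ≤ q - + 2
      P>0  : 0ℤ < N₁ q f g
      q∣f  : q ∣ f
      q∤g  : ¬ q ∣ g
      sV   : Small 64 (N₁ q f g) (V q f g)
      sU   : Small 64 (N₁ q f g) (U q f g)
      sqV  : Small 64 (N₁ q f g) (q * V q f g)
      sqU  : Small 64 (N₁ q f g) (q * U q f g)

  -- e/2 is so far inside the Voronoi cell of τℤ[τ] that eω₁ is a difference of two digits.
  record Carry (q f g : ℤ) (e : Zτ) : Set where
    field
      τ∤e : ¬ q ∣ proj₁ e
      -- The two traces are `Tr (e τ̄)` and `Tr (e τ̄²)`. The bounds `2q` and `2q²` would place
      -- `e/2` in the closed cell of `τℤ[τ]`; the 1 subtracted from them pays for rounding `eω₁/2`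
      -- to a lattice point.
      wide : let (α , γ) = e in
        Hexagon _≤_ (+ 2 * q - + 1) (+ 2 * (q * q) - + 1)
          (α + + 2 * q * γ) (α * (+ 1 - + 2 * q) + γ * q)
      smallA : Small 16 (q * N₁ q f g) (lineA q f g e)
      smallB : Small 16 (q * N₁ q f g) (lineB q f g e)

  -- Each product is at most `P/32` in absolute value, and no side of the hexagon involves more than
  -- three of them. This serves both rounding errors and short offsets.
  Hexagon-small : ∀ P v U qv X Y → 0ℤ < P → Small 64 P v → Small 64 P U → Small 64 P qv →
    0ℤ ≤ X + + 2 → 0ℤ ≤ + 2 - X → 0ℤ ≤ Y + + 2 → 0ℤ ≤ + 2 - Y →
    Hexagon _<_ P P (X * v + Y * U) (X * (v - U) + Y * qv)
  Hexagon-small P v U qv X Y P>0 sv sU sqv h h′ k k′ =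
    let small a a′ = Small-* P X v h h′ sv
        small b b′ = Small-* P Y U k k′ sU
        small c c′ = Small-* P X U h h′ sU
        small d d′ = Small-* P Y qv k k′ sqv
    in hexagon
    (by< 32 (30 ·⁺ P>0 ⊞⁺ a ⊞ b) (solve (P ∷ v ∷ U ∷ qv ∷ X ∷ Y ∷ [])))
    (by< 32 (30 ·⁺ P>0 ⊞⁺ a′ ⊞ b′) (solve (P ∷ v ∷ U ∷ qv ∷ X ∷ Y ∷ [])))
    (by< 32 (29 ·⁺ P>0 ⊞⁺ a ⊞ c′ ⊞ d) (solve (P ∷ v ∷ U ∷ qv ∷ X ∷ Y ∷ [])))
    (by< 32 (29 ·⁺ P>0 ⊞⁺ a′ ⊞ c ⊞ d′) (solve (P ∷ v ∷ U ∷ qv ∷ X ∷ Y ∷ [])))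
    (by< 32 (29 ·⁺ P>0 ⊞⁺ c′ ⊞ b′ ⊞ d) (solve (P ∷ v ∷ U ∷ qv ∷ X ∷ Y ∷ [])))
    (by< 32 (29 ·⁺ P>0 ⊞⁺ c ⊞ b ⊞ d′) (solve (P ∷ v ∷ U ∷ qv ∷ X ∷ Y ∷ [])))

  positive-from-2 : ∀ q → 0ℤ ≤ q - + 2 → 0ℤ < q
  positive-from-2 q h = by< 1 (2 ·⁺ 0<1 ⊞⁺ h) (solve (q ∷ []))

  -- Polynomial identities for the digits and the carry

  module _ where

    τr₁ : ∀ q x y → proj₁ (mulτ (+ 1) q tauτ (x , y)) ≡ - y * q
    τr₁ = NR.solve 3 (λ q x y → proj₁ (mulᴱ 1ᴱ q tauᴱ (x , y)) , ⊝ y ⊗ q) refl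

    d₁A : ∀ q f g α γ d d′ → let E = mulτ (+ 1) q (α , γ) (f , g) in
      N₁ q f g * (α + + 2 * q * γ) + lineA q f g (+ 2 * d - proj₁ E , + 2 * d′ - proj₂ E) ≡ + 2 * lineA q f g (d , d′)
    d₁A = NR.solve 7 (λ q f g α γ d d′ → let E = mulᴱ 1ᴱ q (α , γ) (f , g) in
      normᴱ 1ᴱ q (f , g) ⊗ (α ⊕ 2ᴱ ⊗ q ⊗ γ) ⊕ lineAᴱ q f g (2ᴱ ⊗ d ⊖ proj₁ E , 2ᴱ ⊗ d′ ⊖ proj₂ E) , 2ᴱ ⊗ lineAᴱ q f g (d , d′)) refl

    d₁B : ∀ q f g α γ d d′ → let E = mulτ (+ 1) q (α , γ) (f , g) in
      N₁ q f g * (α * (+ 1 - + 2 * q) + γ * q) + lineB q f g (+ 2 * d - proj₁ E , + 2 * d′ - proj₂ E) ≡ + 2 * lineB q f g (d , d′)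
    d₁B = NR.solve 7 (λ q f g α γ d d′ → let E = mulᴱ 1ᴱ q (α , γ) (f , g) in
      normᴱ 1ᴱ q (f , g) ⊗ (α ⊗ (1ᴱ ⊖ 2ᴱ ⊗ q) ⊕ γ ⊗ q) ⊕ lineBᴱ q f g (2ᴱ ⊗ d ⊖ proj₁ E , 2ᴱ ⊗ d′ ⊖ proj₂ E) , 2ᴱ ⊗ lineBᴱ q f g (d , d′)) refl

    cA : ∀ q f g α γ d d′ → let E = mulτ (+ 1) q (α , γ) (f , g) in
      - (N₁ q f g * (α + + 2 * q * γ)) + lineA q f g (+ 2 * d - proj₁ E , + 2 * d′ - proj₂ E) ≡ + 2 * lineA q f g (subτ (d , d′) E)
    cA = NR.solve 7 (λ q f g α γ d d′ → let E = mulᴱ 1ᴱ q (α , γ) (f , g) in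
      ⊝ (normᴱ 1ᴱ q (f , g) ⊗ (α ⊕ 2ᴱ ⊗ q ⊗ γ)) ⊕ lineAᴱ q f g (2ᴱ ⊗ d ⊖ proj₁ E , 2ᴱ ⊗ d′ ⊖ proj₂ E) , 2ᴱ ⊗ lineAᴱ q f g (subᴱ (d , d′) E)) refl

    cB : ∀ q f g α γ d d′ → let E = mulτ (+ 1) q (α , γ) (f , g) in
      - (N₁ q f g * (α * (+ 1 - + 2 * q) + γ * q)) + lineB q f g (+ 2 * d - proj₁ E , + 2 * d′ - proj₂ E) ≡ + 2 * lineB q f g (subτ (d , d′) E)
    cB = NR.solve 7 (λ q f g α γ d d′ → let E = mulᴱ 1ᴱ q (α , γ) (f , g) in
      ⊝ (normᴱ 1ᴱ q (f , g) ⊗ (α ⊗ (1ᴱ ⊖ 2ᴱ ⊗ q) ⊕ γ ⊗ q)) ⊕ lineBᴱ q f g (2ᴱ ⊗ d ⊖ proj₁ E , 2ᴱ ⊗ d′ ⊖ proj₂ E) , 2ᴱ ⊗ lineBᴱ q f g (subᴱ (d , d′) E)) refl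

    d₂A : ∀ q f g α γ x y → let a = + 2 * x + q * g ; b = + 2 * y - f - g in
      q * N₁ q f g + lineA q f g (a , b) - lineB q f g (a , b) - + 2 * lineA q f g (α , γ)
        ≡ + 2 * lineA q f g (subτ (mulτ (+ 1) q tauτ (x , y)) (α , γ))
    d₂A = NR.solve 7 (λ q f g α γ x y → let a = 2ᴱ ⊗ x ⊕ q ⊗ g ; b = 2ᴱ ⊗ y ⊖ f ⊖ g in
      q ⊗ normᴱ 1ᴱ q (f , g) ⊕ lineAᴱ q f g (a , b) ⊖ lineBᴱ q f g (a , b) ⊖ 2ᴱ ⊗ lineAᴱ q f g (α , γ)
        , 2ᴱ ⊗ lineAᴱ q f g (subᴱ (mulᴱ 1ᴱ q tauᴱ (x , y)) (α , γ))) refl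

    d₂B : ∀ q f g α γ x y → let a = + 2 * x + q * g ; b = + 2 * y - f - g in
      + 2 * q * (q * N₁ q f g) + q * lineA q f g (a , b) - + 2 * lineB q f g (α , γ)
        ≡ + 2 * lineB q f g (subτ (mulτ (+ 1) q tauτ (x , y)) (α , γ))
    d₂B = NR.solve 7 (λ q f g α γ x y → let a = 2ᴱ ⊗ x ⊕ q ⊗ g ; b = 2ᴱ ⊗ y ⊖ f ⊖ g in
      2ᴱ ⊗ q ⊗ (q ⊗ normᴱ 1ᴱ q (f , g)) ⊕ q ⊗ lineAᴱ q f g (a , b) ⊖ 2ᴱ ⊗ lineBᴱ q f g (α , γ)
        , 2ᴱ ⊗ lineBᴱ q f g (subᴱ (mulᴱ 1ᴱ q tauᴱ (x , y)) (α , γ))) refl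

    rA : ∀ q f g x y → let a = + 2 * x + q * g ; b = + 2 * y - f - g in
      lineA q f g (a , b) - + 2 * (q * N₁ q f g) ≡ + 2 * lineA q f g (subτ (x , y) (mulτ (+ 1) q tauτ (f , g)))
    rA = NR.solve 5 (λ q f g x y → let a = 2ᴱ ⊗ x ⊕ q ⊗ g ; b = 2ᴱ ⊗ y ⊖ f ⊖ g in
      lineAᴱ q f g (a , b) ⊖ 2ᴱ ⊗ (q ⊗ normᴱ 1ᴱ q (f , g)) , 2ᴱ ⊗ lineAᴱ q f g (subᴱ (x , y) (mulᴱ 1ᴱ q tauᴱ (f , g)))) refl

    rB : ∀ q f g x y → let a = + 2 * x + q * g ; b = + 2 * y - f - g in
      lineB q f g (a , b) - q * N₁ q f g ≡ + 2 * lineB q f g (subτ (x , y) (mulτ (+ 1) q tauτ (f , g)))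
    rB = NR.solve 5 (λ q f g x y → let a = 2ᴱ ⊗ x ⊕ q ⊗ g ; b = 2ᴱ ⊗ y ⊖ f ⊖ g in
      lineBᴱ q f g (a , b) ⊖ q ⊗ normᴱ 1ᴱ q (f , g) , 2ᴱ ⊗ lineBᴱ q f g (subᴱ (x , y) (mulᴱ 1ᴱ q tauᴱ (f , g)))) refl

    carryᴱ : ∀ {n} (q f g α γ d d′ x y : Expr ℤ n) → (Expr ℤ n × Expr ℤ n) × (Expr ℤ n × Expr ℤ n)
    carryᴱ q f g α γ d d′ x y =
        addᴱ (d , d′) (mulᴱ 1ᴱ q (f , g) (subᴱ (mulᴱ 1ᴱ q tauᴱ (x , y)) (α , γ)))
      , addᴱ (subᴱ (d , d′) (mulᴱ 1ᴱ q (α , γ) (f , g))) (mulᴱ 1ᴱ q ω (addᴱ (subᴱ (x , y) ω) ω))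
      where ω = mulᴱ 1ᴱ q tauᴱ (f , g)

    carry-identity : ∀ q f g α γ d d′ x y → let ω = mulτ (+ 1) q tauτ (f , g) in
      addτ (d , d′) (mulτ (+ 1) q (f , g) (subτ (mulτ (+ 1) q tauτ (x , y)) (α , γ)))
        ≡ addτ (subτ (d , d′) (mulτ (+ 1) q (α , γ) (f , g))) (mulτ (+ 1) q ω (addτ (subτ (x , y) ω) ω))
    carry-identity q f g α γ d d′ x y = cong₂ _,_
      (NR.solve 9 (λ q f g α γ d d′ x y → let (l , r) = carryᴱ q f g α γ d d′ x y in proj₁ l , proj₁ r) refl q f g α γ d d′ x y)
      (NR.solve 9 (λ q f g α γ d d′ x y → let (l , r) = carryᴱ q f g α γ d d′ x y in proj₂ l , proj₂ r) refl q f g α γ d d′ x y)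

  -- 2r - ω for r = r₁ + r₂τ
  offset : (q f g r₁ r₂ : ℤ) → Zτ
  offset q f g r₁ r₂ = + 2 * r₁ + q * g , + 2 * r₂ - f - g

  -- What remains afterwards is the choice of `e` and `r`. The condition on `lineB` of the offset
  -- keeps `r` near the midpoint in the direction along the facet.
  module CoreFromShift {q f g : ℤ} (red : Reduced q f g)
    {e : Zτ} (carry-e : Carry q f g e) (r₁ r₂ : ℤ) (τ∤r : ¬ q ∣ r₁)
    (η>0 : 0ℤ < lineA q f g (offset q f g r₁ r₂))
    (facet : 0ℤ < + 2 * lineB q f g e - q * lineA q f g (offset q f g r₁ r₂))
    (smallζ : Small 2 (q * N₁ q f g) (lineB q f g (offset q f g r₁ r₂)))
    where

    open Reduced red
    open Carry carry-e

    private
      α = proj₁ e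
      γ = proj₂ e
      η = lineA q f g (offset q f g r₁ r₂)
      ζ = lineB q f g (offset q f g r₁ r₂)
      P = N₁ q f g
      Q = q * P
      q>0 = positive-from-2 q q≥2
      E = mulτ (+ 1) q e (f , g)
      ω = mulτ (+ 1) q tauτ (f , g)

      d-choice = half-indivisible q (proj₁ E) q≥2
      d′-choice = half (proj₂ E)

      d = proj₁ d-choice
      d′ = proj₁ d′-choice

      open Perturbation q Q η ζ (lineA q f g e) (lineB q f g e) q≥2 (q>0 ⊠⁺ P>0) η>0 facet smallζ smallA smallB

      X = + 2 * d - proj₁ E
      Y = + 2 * d′ - proj₂ E

      ε-small : Hexagon _<_ P P (lineA q f g (X , Y)) (lineB q f g (X , Y))
      ε-small = let (_ , _ , h , h′) = d-choice ; (_ , k , k′) = d′-choice in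
        Hexagon-small P (V q f g) (U q f g) (q * V q f g) X Y P>0 sV sU sqV h h′ k k′

      E-wide : Hexagon _≤_ (+ 2 * Q - P) (q * (+ 2 * Q) - P)
        (P * (α + + 2 * q * γ)) (P * (α * (+ 1 - + 2 * q) + γ * q))
      E-wide = Hexagon-scale P (+ 2 * q - + 1) (+ 2 * (q * q) - + 1)
        (α + + 2 * q * γ) (α * (+ 1 - + 2 * q) + γ * q) (<⇒≤ P>0) wide (lem₁ q P) (lem₂ q P) refl refl
        where
        lem₁ : ∀ q P → + 2 * (q * P) - P ≡ P * (+ 2 * q - + 1)
        lem₁ = solve-∀
        lem₂ : ∀ q P → q * (+ 2 * (q * P)) - P ≡ P * (+ 2 * (q * q) - + 1)
        lem₂ = solve-∀

    core : Core q f g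
    core = record
      { d₁ = d , d′
      ; d₂ = subτ (mulτ (+ 1) q tauτ (r₁ , r₂)) e
      ; c = subτ (d , d′) E
      ; r = subτ (r₁ , r₂) ω
      ; good-d₁ = good (Inside-half q Q _ _ (Hexagon-+ (+ 2 * Q) (q * (+ 2 * Q)) P _ _ _ _ ε-small E-wide)
          (d₁A q f g α γ d d′) (d₁B q f g α γ d d′)) (proj₁ (proj₂ d-choice))
      ; good-d₂ = good (Inside-half q Q _ _ Inside-high-digit (d₂A q f g α γ r₁ r₂) (d₂B q f g α γ r₁ r₂))
          (λ h → τ∤e (subst (q ∣_) (neg-involutive α) (∣m⇒∣-m
            (∣m+n∣m⇒∣n h (divides (- r₂) (τr₁ q r₁ r₂))))))
      ; good-c = good (Inside-half q Q _ _ (Hexagon-+ (+ 2 * Q) (q * (+ 2 * Q)) P _ _ _ _ ε-small (Hexagon-neg _ _ _ _ E-wide))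
          (cA q f g α γ d d′) (cB q f g α γ d d′))
          -- `τ` divides `ω₁`, hence `eω₁`, so `c = d₁ - eω₁` is divisible by `τ` only if `d₁` is.
          (λ h → proj₁ (proj₂ d-choice) (∣m+n∣n⇒∣m h (∣m⇒∣-m q∣E₁)))
      ; good-r = good (Inside-half q Q _ _ Inside-quotient (rA q f g r₁ r₂) (rB q f g r₁ r₂))
          (λ h → τ∤r (∣m+n∣n⇒∣m h (∣m⇒∣-m (divides (- g) (τr₁ q f g)))))
      ; carry = carry-identity q f g α γ d d′ r₁ r₂
      }
      where
      q∣E₁ : q ∣ proj₁ E
      q∣E₁ = ∣m∣n⇒∣m-n (∣n⇒∣m*n α q∣f) (divides (γ * g) (*-comm q (γ * g)))

  compare : ∀ x y → 0ℤ < x - y ⊎ 0ℤ < y - x ⊎ x ≡ y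
  compare x y with <-cmp x y
  ... | tri< x<y _ _ = inj₂ (inj₁ (subst (_< y - x) (+-inverseʳ x) (+-monoˡ-< (- x) x<y)))
  ... | tri≈ _ x≡y _ = inj₂ (inj₂ x≡y)
  ... | tri> _ _ y<x = inj₁ (subst (_< x - y) (+-inverseʳ y) (+-monoˡ-< (- y) y<x))

  -- Estimates for the carries `1 - q + τ`, `-1 + τ` and `1 - q`

  module _ (q P v U : ℤ) (q≥2 : 0ℤ ≤ q - + 2) (P>0 : 0ℤ < P)
    (sv : Small 64 P v) (sU : Small 64 P U) (sqv : Small 64 P (q * v)) (sqU : Small 64 P (q * U)) where

    private
      P≥0 = <⇒≤ P>0
      qP = q≥2 ⊠ P≥0

      v₁ = Small.≲ sv
      v₂ = Small.≳ sv
      U₁ = Small.≲ sU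
      U₂ = Small.≳ sU
      x₁ = Small.≲ sqv
      x₂ = Small.≳ sqv
      y₁ = Small.≲ sqU
      y₂ = Small.≳ sqU

    smallA₁ : Small 16 (q * P) ((+ 1 - q) * v + + 1 * U)
    smallA₁ = small
      (by≤ 4 (v₁ ⊞ x₂ ⊞ U₁ ⊞ 4 · qP ⊞ 5 · P≥0) (solve (q ∷ P ∷ v ∷ U ∷ [])))
      (by≤ 4 (v₂ ⊞ x₁ ⊞ U₂ ⊞ 4 · qP ⊞ 5 · P≥0) (solve (q ∷ P ∷ v ∷ U ∷ [])))

    smallB₁ : Small 16 (q * P) ((+ 1 - q) * (v - U) + + 1 * (q * v))
    smallB₁ = small
      (by≤ 4 (v₁ ⊞ y₁ ⊞ U₂ ⊞ 4 · qP ⊞ 5 · P≥0) (solve (q ∷ P ∷ v ∷ U ∷ [])))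
      (by≤ 4 (v₂ ⊞ y₂ ⊞ U₁ ⊞ 4 · qP ⊞ 5 · P≥0) (solve (q ∷ P ∷ v ∷ U ∷ [])))

    smallA₂ : Small 16 (q * P) (-1ℤ * v + + 1 * U)
    smallA₂ = small
      (by≤ 4 (v₂ ⊞ U₁ ⊞ 4 · qP ⊞ 6 · P≥0) (solve (q ∷ P ∷ v ∷ U ∷ [])))
      (by≤ 4 (v₁ ⊞ U₂ ⊞ 4 · qP ⊞ 6 · P≥0) (solve (q ∷ P ∷ v ∷ U ∷ [])))

    smallB₂ : Small 16 (q * P) (-1ℤ * (v - U) + + 1 * (q * v))
    smallB₂ = small
      (by≤ 4 (v₂ ⊞ U₁ ⊞ x₁ ⊞ 4 · qP ⊞ 5 · P≥0) (solve (q ∷ P ∷ v ∷ U ∷ [])))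
      (by≤ 4 (v₁ ⊞ U₂ ⊞ x₂ ⊞ 4 · qP ⊞ 5 · P≥0) (solve (q ∷ P ∷ v ∷ U ∷ [])))

    smallA₃ : Small 16 (q * P) ((+ 1 - q) * v + + 0 * U)
    smallA₃ = small
      (by≤ 4 (v₁ ⊞ x₂ ⊞ 4 · qP ⊞ 6 · P≥0) (solve (q ∷ P ∷ v ∷ U ∷ [])))
      (by≤ 4 (v₂ ⊞ x₁ ⊞ 4 · qP ⊞ 6 · P≥0) (solve (q ∷ P ∷ v ∷ U ∷ [])))

    smallB₃ : Small 16 (q * P) ((+ 1 - q) * (v - U) + + 0 * (q * v))
    smallB₃ = small
      (by≤ 4 (v₁ ⊞ U₂ ⊞ x₂ ⊞ y₁ ⊞ 4 · qP ⊞ 4 · P≥0) (solve (q ∷ P ∷ v ∷ U ∷ [])))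
      (by≤ 4 (v₂ ⊞ U₁ ⊞ x₁ ⊞ y₂ ⊞ 4 · qP ⊞ 4 · P≥0) (solve (q ∷ P ∷ v ∷ U ∷ [])))

  wide₁ : ∀ q → 0ℤ ≤ q - + 2 → let α = + 1 - q ; γ = + 1 in
    Hexagon _≤_ (+ 2 * q - + 1) (+ 2 * (q * q) - + 1) (α + + 2 * q * γ) (α * (+ 1 - + 2 * q) + γ * q)
  wide₁ q t = hexagon
    (by≤ 1 t (solve (q ∷ [])))
    (by≤ 1 (3 · t ⊞ 0≤+ 6) (solve (q ∷ [])))
    (by≤ 1 (2 · t ⊞ 0≤+ 2) (solve (q ∷ [])))
    (by≤ 1 (4 · (t ⊠ t) ⊞ 14 · t ⊞ 0≤+ 12) (solve (q ∷ [])))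
    (by≤ 1 (3 · t ⊞ 0≤+ 5) (solve (q ∷ [])))
    (by≤ 1 (4 · (t ⊠ t) ⊞ 13 · t ⊞ 0≤+ 9) (solve (q ∷ [])))

  wide₂ : ∀ q → 0ℤ ≤ q - + 2 → let α = -1ℤ ; γ = + 1 in
    Hexagon _≤_ (+ 2 * q - + 1) (+ 2 * (q * q) - + 1) (α + + 2 * q * γ) (α * (+ 1 - + 2 * q) + γ * q)
  wide₂ q t = hexagon
    (by≤ 1 (0≤+ 0) (solve (q ∷ [])))
    (by≤ 1 (4 · t ⊞ 0≤+ 6) (solve (q ∷ [])))
    (by≤ 1 (2 · (t ⊠ t) ⊞ 5 · t ⊞ 0≤+ 2) (solve (q ∷ [])))
    (by≤ 1 (2 · (t ⊠ t) ⊞ 11 · t ⊞ 0≤+ 12) (solve (q ∷ [])))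
    (by≤ 1 (2 · (t ⊠ t) ⊞ 7 · t ⊞ 0≤+ 5) (solve (q ∷ [])))
    (by≤ 1 (2 · (t ⊠ t) ⊞ 9 · t ⊞ 0≤+ 9) (solve (q ∷ [])))

  wide₃ : ∀ q → 0ℤ ≤ q - + 2 → let α = + 1 - q ; γ = + 0 in
    Hexagon _≤_ (+ 2 * q - + 1) (+ 2 * (q * q) - + 1) (α + + 2 * q * γ) (α * (+ 1 - + 2 * q) + γ * q)
  wide₃ q t = hexagon
    (by≤ 1 (3 · t ⊞ 0≤+ 4) (solve (q ∷ [])))
    (by≤ 1 (t ⊞ 0≤+ 2) (solve (q ∷ [])))
    (by≤ 1 (3 · t ⊞ 0≤+ 4) (solve (q ∷ [])))
    (by≤ 1 (4 · (t ⊠ t) ⊞ 13 · t ⊞ 0≤+ 10) (solve (q ∷ [])))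
    (by≤ 1 (2 · t ⊞ 0≤+ 3) (solve (q ∷ [])))
    (by≤ 1 (4 · (t ⊠ t) ⊞ 14 · t ⊞ 0≤+ 11) (solve (q ∷ [])))

  -- Signs, sizes and divisibility of `V` and `U`

  Unit : ℤ → Set
  Unit s = s ≡ + 1 ⊎ s ≡ -1ℤ

  ∤unit : ∀ {q s} → 0ℤ ≤ q - + 2 → Unit s → ¬ q ∣ s
  ∤unit q≥2 (inj₁ refl) h = ∤1 q≥2 h
  ∤unit q≥2 (inj₂ refl) h = ∤1 q≥2 (∣m⇒∣-m h)

  Unit-bounds : ∀ {s} → Unit s → 0ℤ ≤ s + + 2 × 0ℤ ≤ + 2 - s
  Unit-bounds (inj₁ refl) = 0≤+ 3 , 0≤+ 1
  Unit-bounds (inj₂ refl) = 0≤+ 1 , 0≤+ 3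

  unit-sign : ∀ v → v ≢ 0ℤ → Σ ℤ λ s → Unit s × 0ℤ < s * v
  unit-sign +[1+ n ] _ = + 1 , inj₁ refl , +<+ (s≤s z≤n)
  unit-sign +0 h = contradiction refl h
  unit-sign -[1+ n ] _ = -1ℤ , inj₂ refl , +<+ (s≤s z≤n)

  -- Modulo `q`, `V` is congruent to `g`, because `q` divides `f`. As `q` divides `U`, this rules
  -- out all ties between `U` and `|V|`.
  q∤V : ∀ {q f g} → Reduced q f g → ¬ q ∣ V q f g
  q∤V {q} {f} {g} red h = q∤g (∣m+n∣n⇒∣m {m = g} {n = - + 2 * g * q} (subst (q ∣_) (lem q g) (∣m+n∣m⇒∣n h q∣f)) (divides (- + 2 * g) refl))
    where
    open Reduced red
    lem : ∀ q g → (+ 1 - + 2 * q) * g ≡ g + - + 2 * g * q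
    lem = solve-∀

  odd≢even : ∀ x y → + 1 + + 2 * x ≢ + 2 * y
  odd≢even x y eq = ∤1 {+ 2} (0≤+ 0) (∣m+n∣n⇒∣m {m = + 1} (subst (+ 2 ∣_) (sym eq) (divides y (*-comm (+ 2) y))) (divides x (*-comm (+ 2) x)))

  -- This is `|Tr ω| ≤ 2|ω|`. The number `2U - V` is `4q - 1` times the coefficient `f + g` of `τ`
  -- in `ω`, so its square is the difference times `4q - 1`.
  V²≤4Q : ∀ q f g → 0ℤ ≤ q - + 2 → 0ℤ ≤ + 4 * (q * N₁ q f g) - V q f g * V q f g
  V²≤4Q q f g q≥2 = cancel≤ (by< 1 (7 ·⁺ 0<1 ⊞⁺ 4 · q≥2) (D-form q)) (subst (0ℤ ≤_) (discriminant q f g) (square≥0 (+ 2 * U q f g - V q f g)))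
    where
    D-form : ∀ q → + 7 * + 1 + + 4 * (q - + 2) ≡ + 1 * (+ 4 * q - + 1)
    D-form = solve-∀
    discriminant : ∀ q f g → let w = + 2 * U q f g - V q f g in
      w * w ≡ (+ 4 * q - + 1) * (+ 4 * (q * N₁ q f g) - V q f g * V q f g)
    discriminant = NR.solve 3 (λ q f g → let w = 2ᴱ ⊗ Uᴱ q f g ⊖ Vᴱ q f g in
      w ⊗ w , (Κ (+ 4) ⊗ q ⊖ 1ᴱ) ⊗ (Κ (+ 4) ⊗ (q ⊗ normᴱ 1ᴱ q (f , g)) ⊖ Vᴱ q f g ⊗ Vᴱ q f g)) refl

  u²≤4P : ∀ q f g → 0ℤ ≤ q - + 2 → let u = + 2 * f + g in 0ℤ ≤ + 4 * N₁ q f g - u * u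
  u²≤4P q f g q≥2 = subst (0ℤ ≤_) (discriminant q f g) ((4 · q≥2 ⊞ 0≤+ 7) ⊠ square≥0 g)
    where
    discriminant : ∀ q f g → let u = + 2 * f + g in
      (+ 4 * (q - + 2) + + 7) * (g * g) ≡ + 4 * N₁ q f g - u * u
    discriminant = NR.solve 3 (λ q f g → let u = 2ᴱ ⊗ f ⊕ g in
      (Κ (+ 4) ⊗ (q ⊖ 2ᴱ) ⊕ Κ (+ 7)) ⊗ (g ⊗ g) , Κ (+ 4) ⊗ normᴱ 1ᴱ q (f , g) ⊖ u ⊗ u) refl

  -- The sign `s` makes `s * V = |V|`, and `U > 0` is arranged by passing to `-ω₁`. The coordinates
  -- of the offset `2r - ω` are congruent to `q * g` and `f + g` modulo 2, so the parities decide
  -- which offsets are available.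
  module Shifts {q f g : ℤ} (red : Reduced q f g) (U>0 : 0ℤ < U q f g)
    {s : ℤ} (unit : Unit s) (sV>0 : 0ℤ < s * V q f g) where

    open Reduced red

    private
      P = N₁ q f g
      Q = q * P
      v = V q f g
      u = + 2 * f + g
      u′ = U q f g
      U≥0 = <⇒≤ U>0
      sV≥0 = <⇒≤ sV>0
      q>0 = positive-from-2 q q≥2

      q∤1-q : ¬ q ∣ + 1 - q
      q∤1-q h = ∤1 q≥2 (∣m+n∣n⇒∣m h (∣m⇒∣-m ∣-refl))

      carry₁ : Carry q f g (+ 1 - q , + 1)
      carry₁ = record { τ∤e = q∤1-q ; wide = wide₁ q q≥2
        ; smallA = smallA₁ q P v u′ q≥2 P>0 sV sU sqV sqU ; smallB = smallB₁ q P v u′ q≥2 P>0 sV sU sqV sqU }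

      carry₂ : Carry q f g (-1ℤ , + 1)
      carry₂ = record { τ∤e = ∤unit q≥2 (inj₂ refl) ; wide = wide₂ q q≥2
        ; smallA = smallA₂ q P v u′ q≥2 P>0 sV sU sqV sqU ; smallB = smallB₂ q P v u′ q≥2 P>0 sV sU sqV sqU }

      carry₃ : Carry q f g (+ 1 - q , + 0)
      carry₃ = record { τ∤e = q∤1-q ; wide = wide₃ q q≥2
        ; smallA = smallA₃ q P v u′ q≥2 P>0 sV sU sqV sqU ; smallB = smallB₃ q P v u′ q≥2 P>0 sV sU sqV sqU }

    -- lineB of the carries 1 - q + τ, -1 + τ and 1 - q is V + (q - 1)U, (q - 1)V + U and
    -- (q - 1)(U - V); which of them suits depends on the sign of V.
    large-carry-U : Σ Zτ λ e → Carry q f g e × 0ℤ ≤ lineB q f g e - ((q - + 1) * u′ + s * v)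
    large-carry-U = choose unit
      where
      lem₁ : ∀ q v U → 0ℤ ≤ (+ 1 - q) * (v - U) + + 1 * (q * v) - ((q - + 1) * U + + 1 * v)
      lem₁ q v U = by≤ 1 (0≤+ 0) (solve (q ∷ v ∷ U ∷ []))
      lem₂ : ∀ q v U → 0ℤ ≤ q - + 2 → 0ℤ ≤ -1ℤ * v → 0ℤ ≤ (+ 1 - q) * (v - U) + + 0 * (q * v) - ((q - + 1) * U + -1ℤ * v)
      lem₂ q v U h k = by≤ 1 (h ⊠ k) (solve (q ∷ v ∷ U ∷ []))
      choose : Unit s → Σ Zτ λ e → Carry q f g e × 0ℤ ≤ lineB q f g e - ((q - + 1) * u′ + s * v)
      choose (inj₁ s≡1) = _ , carry₁ , subst (λ s → 0ℤ ≤ lineB q f g (+ 1 - q , + 1) - ((q - + 1) * u′ + s * v)) (sym s≡1) (lem₁ q v u′)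
      choose (inj₂ s≡-1) = _ , carry₃ , subst (λ s → 0ℤ ≤ lineB q f g (+ 1 - q , + 0) - ((q - + 1) * u′ + s * v)) (sym s≡-1)
        (lem₂ q v u′ q≥2 (subst (λ s → 0ℤ ≤ s * v) s≡-1 sV≥0))

    large-carry-V : Σ Zτ λ e → Carry q f g e × 0ℤ ≤ lineB q f g e - ((q - + 1) * (s * v) + u′)
    large-carry-V = choose unit
      where
      lem₁ : ∀ q v U → 0ℤ ≤ -1ℤ * (v - U) + + 1 * (q * v) - ((q - + 1) * (+ 1 * v) + U)
      lem₁ q v U = by≤ 1 (0≤+ 0) (solve (q ∷ v ∷ U ∷ []))
      lem₂ : ∀ q v U → 0ℤ ≤ q - + 2 → 0ℤ ≤ U → 0ℤ ≤ (+ 1 - q) * (v - U) + + 0 * (q * v) - ((q - + 1) * (-1ℤ * v) + U)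
      lem₂ q v U h k = by≤ 1 (h ⊠ k) (solve (q ∷ v ∷ U ∷ []))
      choose : Unit s → Σ Zτ λ e → Carry q f g e × 0ℤ ≤ lineB q f g e - ((q - + 1) * (s * v) + u′)
      choose (inj₁ s≡1) = _ , carry₂ , subst (λ s → 0ℤ ≤ lineB q f g (-1ℤ , + 1) - ((q - + 1) * (s * v) + u′)) (sym s≡1) (lem₁ q v u′)
      choose (inj₂ s≡-1) = _ , carry₃ , subst (λ s → 0ℤ ≤ lineB q f g (+ 1 - q , + 0) - ((q - + 1) * (s * v) + u′)) (sym s≡-1)
        (lem₂ q v u′ q≥2 U≥0)

    shift : ∀ {e} → Carry q f g e → ∀ {a b} r₁ r₂ → + 2 * r₁ + q * g ≡ a → + 2 * r₂ - f - g ≡ b →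
      ¬ q ∣ r₁ → 0ℤ < a * v + b * u′ → 0ℤ < + 2 * lineB q f g e - q * (a * v + b * u′) →
      Small 2 Q (a * (v - u′) + b * (q * v)) → Core q f g
    shift c r₁ r₂ refl refl τ∤r η>0 facet ζ-small = CoreFromShift.core red c r₁ r₂ τ∤r η>0 facet ζ-small

    small-shift : ∀ a b → 0ℤ ≤ a + + 2 → 0ℤ ≤ + 2 - a → 0ℤ ≤ b + + 2 → 0ℤ ≤ + 2 - b →
      Small 2 Q (a * (v - u′) + b * (q * v))
    small-shift a b h h′ k k′ = let hexagon _ _ x y _ _ = Hexagon-small P v u′ (q * v) a b P>0 sV sU sqV h h′ k k′ in
      bound q P (a * (v - u′) + b * (q * v)) q≥2 (<⇒≤ P>0) (<⇒≤ x) (<⇒≤ y)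
      where
      bound : ∀ q P X → 0ℤ ≤ q - + 2 → 0ℤ ≤ P → 0ℤ ≤ P - X → 0ℤ ≤ P + X → Small 2 (q * P) X
      bound q P X h p x y = small
        (by≤ 1 (h ⊠ p ⊞ 2 · x) (solve (q ∷ P ∷ X ∷ [])))
        (by≤ 1 (h ⊠ p ⊞ 2 · y) (solve (q ∷ P ∷ X ∷ [])))

    q∣shift : ∀ r₁ → q ∣ r₁ → q ∣ + 2 * r₁ + q * g
    q∣shift r₁ h = ∣m∣n⇒∣m+n (∣n⇒∣m*n (+ 2) h) (divides g (*-comm q g))

    -- The offset is `τ`, so `η = U`, and the facet condition has slack at least `(q - 2)U + 2|V|`.
    -- Here `r₁ = -(q/2)g` is not divisible by `q` because `g` is odd.
    core-even-q : ∀ q₁ f₁ g₁ → q ≡ + 2 * q₁ → f ≡ + 2 * f₁ → g ≡ + 1 + + 2 * g₁ → Core q f g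
    core-even-q q₁ f₁ g₁ q-even f-even g-odd =
      let (e , c , h) = large-carry-U in
      shift c (- (q₁ * g)) (+ 1 + f₁ + g₁)
        (trans (cong (λ q → + 2 * - (q₁ * g) + q * g) q-even) (first q₁ g))
        (trans (cong₂ (λ f g → + 2 * (+ 1 + f₁ + g₁) - f - g) f-even g-odd) (second f₁ g₁))
        indivisible
        (by< 1 U>0 (η-form v u′))
        (facet (lineB q f g e) q v u′ s h q≥2 sV>0 U≥0)
        (small-shift (+ 0) (+ 1) (0≤+ 2) (0≤+ 2) (0≤+ 3) (0≤+ 1))
      where
      first : ∀ q₁ g → + 2 * - (q₁ * g) + + 2 * q₁ * g ≡ + 0
      first = solve-∀
      second : ∀ f₁ g₁ → + 2 * (+ 1 + f₁ + g₁) - + 2 * f₁ - (+ 1 + + 2 * g₁) ≡ + 1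
      second = solve-∀
      η-form : ∀ v U → U ≡ + 1 * (+ 0 * v + + 1 * U)
      η-form = solve-∀
      facet : ∀ B q v U s → 0ℤ ≤ B - ((q - + 1) * U + s * v) → 0ℤ ≤ q - + 2 → 0ℤ < s * v → 0ℤ ≤ U →
        0ℤ < + 2 * B - q * (+ 0 * v + + 1 * U)
      facet B q v U s h t sV>0 U≥0 = by< 1 (2 ·⁺ sV>0 ⊞⁺ 2 · h ⊞ t ⊠ U≥0) (solve (B ∷ q ∷ v ∷ U ∷ s ∷ []))
      indivisible : ¬ q ∣ - (q₁ * g)
      indivisible (divides k eq) = odd≢even g₁ (- k) (trans (sym g-odd)
        (*-cancelˡ-≡ q₁ g (+ 2 * - k) {{q₁≢0}} (trans (trans (sym (neg-involutive (q₁ * g))) (cong -_ (trans eq (cong (k *_) q-even)))) (rearrange k q₁))))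
        where
        rearrange : ∀ k q₁ → - (k * (+ 2 * q₁)) ≡ q₁ * (+ 2 * - k)
        rearrange = solve-∀
        q₁≢0 : NonZero q₁
        q₁≢0 = >-nonZero (by< 2 q>0 q-even)

    q∤sV : ¬ q ∣ s * v
    q∤sV = choose unit
      where
      choose : Unit s → ¬ q ∣ s * v
      choose (inj₁ s≡1) h = q∤V red (subst (q ∣_) (trans (cong (_* v) s≡1) (*-identityˡ v)) h)
      choose (inj₂ s≡-1) h = q∤V red (subst (q ∣_) (neg-involutive v) (∣m⇒∣-m (subst (q ∣_) (trans (cong (_* v) s≡-1) (-1*i≡-i v)) h)))

    s-odd : Σ ℤ λ σ → s ≡ + 1 + + 2 * σ
    s-odd = [ (λ { refl → + 0 , refl }) , (λ { refl → -1ℤ , refl }) ]′ unit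

    module OddQ (q₁ : ℤ) (q-odd : q ≡ + 1 + + 2 * q₁) where

      q>2 : 0ℤ < q - + 2
      q>2 with compare q (+ 2)
      ... | inj₁ h = h
      ... | inj₂ (inj₁ h) = contradiction (by< 1 (h ⊞⁺ q≥2) (lem q)) (<-irrefl refl)
        where
        lem : ∀ q → + 2 - q + (q - + 2) ≡ + 1 * + 0
        lem = solve-∀
      ... | inj₂ (inj₂ h) = contradiction (trans (sym q-odd) h) (odd≢even q₁ (+ 1))

      module OddG (g₁ : ℤ) (g-odd : g ≡ + 1 + + 2 * g₁) where

        private
          σ = proj₁ s-odd
          ρ = σ - (q₁ + g₁ + + 2 * q₁ * g₁)

          first : + 2 * ρ + q * g ≡ s
          first = trans (cong₂ (λ q g → + 2 * ρ + q * g) q-odd g-odd) (trans (lem σ q₁ g₁) (sym (proj₂ s-odd)))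
            where
            lem : ∀ σ q₁ g₁ → + 2 * (σ - (q₁ + g₁ + + 2 * q₁ * g₁)) + (+ 1 + + 2 * q₁) * (+ 1 + + 2 * g₁) ≡ + 1 + + 2 * σ
            lem = solve-∀

          indivisible : ¬ q ∣ ρ
          indivisible h = ∤unit q≥2 unit (subst (q ∣_) first (q∣shift ρ h))

          s≥ = proj₁ (Unit-bounds unit)
          s≤ = proj₂ (Unit-bounds unit)

        -- The offset is `s`, so `η = |V|`; the roles of `U` and `|V|` are exchanged compared with
        -- even `q`.
        core-odd-f : ∀ f₁ → f ≡ + 1 + + 2 * f₁ → Core q f g
        core-odd-f f₁ f-odd =
          let (e , c , h) = large-carry-V in
          shift c ρ (+ 1 + f₁ + g₁) first
            (trans (cong₂ (λ f g → + 2 * (+ 1 + f₁ + g₁) - f - g) f-odd g-odd) (second f₁ g₁))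
            indivisible
            (by< 1 sV>0 (η-form s v u′))
            (facet (lineB q f g e) q v u′ s h q≥2 sV≥0 U>0)
            (small-shift s (+ 0) s≥ s≤ (0≤+ 2) (0≤+ 2))
          where
          second : ∀ f₁ g₁ → + 2 * (+ 1 + f₁ + g₁) - (+ 1 + + 2 * f₁) - (+ 1 + + 2 * g₁) ≡ + 0
          second = solve-∀
          η-form : ∀ s v U → s * v ≡ + 1 * (s * v + + 0 * U)
          η-form = solve-∀
          facet : ∀ B q v U s → 0ℤ ≤ B - ((q - + 1) * (s * v) + U) → 0ℤ ≤ q - + 2 → 0ℤ ≤ s * v → 0ℤ < U →
            0ℤ < + 2 * B - q * (s * v + + 0 * U)
          facet B q v U s h t sV≥0 U>0 = by< 1 (2 ·⁺ U>0 ⊞⁺ 2 · h ⊞ t ⊠ sV≥0) (solve (B ∷ q ∷ v ∷ U ∷ s ∷ []))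

        -- The offset is `s + τ`, so `η = |V| + U`. With the carry adapted to the larger of `U` and
        -- `|V|`, the slack is at least `q - 2` times their distance, which is positive as `q > 2`
        -- and a tie is impossible.
        core-even-f : ∀ f₁ → f ≡ + 2 * f₁ → Core q f g
        core-even-f f₁ f-even = choose (compare u′ (s * v))
          where
          second : ∀ f₁ g₁ → + 2 * (+ 1 + f₁ + g₁) - + 2 * f₁ - (+ 1 + + 2 * g₁) ≡ + 1
          second = solve-∀
          η-form : ∀ s v U → s * v + U ≡ + 1 * (s * v + + 1 * U)
          η-form = solve-∀

          finish : ∀ {e} → Carry q f g e → 0ℤ < + 2 * lineB q f g e - q * (s * v + + 1 * u′) → Core q f g
          finish c facet = shift c ρ (+ 1 + f₁ + g₁) first
            (trans (cong₂ (λ f g → + 2 * (+ 1 + f₁ + g₁) - f - g) f-even g-odd) (second f₁ g₁))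
            indivisible (by< 1 (sV>0 ⊞⁺ U≥0) (η-form s v u′)) facet
            (small-shift s (+ 1) s≥ s≤ (0≤+ 3) (0≤+ 1))

          facet-U : ∀ B q v U s → 0ℤ ≤ B - ((q - + 1) * U + s * v) → 0ℤ < q - + 2 → 0ℤ < U - s * v →
            0ℤ < + 2 * B - q * (s * v + + 1 * U)
          facet-U B q v U s h t d = by< 1 (t ⊠⁺ d ⊞⁺ 2 · h) (solve (B ∷ q ∷ v ∷ U ∷ s ∷ []))
          facet-V : ∀ B q v U s → 0ℤ ≤ B - ((q - + 1) * (s * v) + U) → 0ℤ < q - + 2 → 0ℤ < s * v - U →
            0ℤ < + 2 * B - q * (s * v + + 1 * U)
          facet-V B q v U s h t d = by< 1 (t ⊠⁺ d ⊞⁺ 2 · h) (solve (B ∷ q ∷ v ∷ U ∷ s ∷ []))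

          choose : 0ℤ < u′ - s * v ⊎ 0ℤ < s * v - u′ ⊎ u′ ≡ s * v → Core q f g
          choose (inj₁ U>V) = let (e , c , h) = large-carry-U in
            finish c (facet-U (lineB q f g e) q v u′ s h q>2 U>V)
          choose (inj₂ (inj₁ V>U)) = let (e , c , h) = large-carry-V in
            finish c (facet-V (lineB q f g e) q v u′ s h q>2 V>U)
          choose (inj₂ (inj₂ U≡V)) = contradiction (divides u (trans (sym U≡V) (*-comm q u))) q∤sV

      -- Here the offset a + bτ must have a ∈ {2, -2} and b odd.  If V is much larger than U, then b is
      -- of size V / U, and r stays close to the facet only because u is not too small.
      module EvenG (g₁ : ℤ) (g-even : g ≡ + 2 * g₁) (f₁ : ℤ) (f-odd : f ≡ + 1 + + 2 * f₁)
        (u≥32 : 0ℤ ≤ u - + 32) where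

        finish : ∀ {e t} → Unit t → ∀ b₁ → Carry q f g e → let a = + 2 * t ; b = + 1 + + 2 * b₁ in
          0ℤ < a * v + b * u′ → 0ℤ < + 2 * lineB q f g e - q * (a * v + b * u′) →
          Small 2 Q (a * (v - u′) + b * (q * v)) → Core q f g
        finish {t = t} t-unit b₁ c η>0 facet ζ-small = shift c (t - q * g₁) (+ 1 + b₁ + f₁ + g₁)
          (trans (cong (λ g → + 2 * (t - q * g₁) + q * g) g-even) (first t q g₁))
          (trans (cong₂ (λ f g → + 2 * (+ 1 + b₁ + f₁ + g₁) - f - g) f-odd g-even) (second b₁ f₁ g₁))
          (λ h → ∤unit q≥2 t-unit (∣m+n∣n⇒∣m h (∣m⇒∣-m (divides g₁ (*-comm q g₁)))))
          η>0 facet ζ-small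
          where
          first : ∀ t q g₁ → + 2 * (t - q * g₁) + q * (+ 2 * g₁) ≡ + 2 * t
          first = solve-∀
          second : ∀ b₁ f₁ g₁ → + 2 * (+ 1 + b₁ + f₁ + g₁) - (+ 1 + + 2 * f₁) - + 2 * g₁ ≡ + 1 + + 2 * b₁
          second = solve-∀

        -- For even `g` also `U/2` is divisible by `q`, while `|V|` is not.
        U≢2V : u′ ≢ + 2 * (s * v)
        U≢2V eq = q∤sV (divides (f + g₁) (*-cancelˡ-≡ (+ 2) (s * v) ((f + g₁) * q)
          (trans (sym eq) (trans (cong (λ g → q * (+ 2 * f + g)) g-even) (lem q f g₁)))))
          where
          lem : ∀ q f g₁ → q * (+ 2 * f + + 2 * g₁) ≡ + 2 * ((f + g₁) * q)
          lem = solve-∀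

        2-bounds : ∀ {t} → Unit t → 0ℤ ≤ + 2 * t + + 2 × 0ℤ ≤ + 2 - + 2 * t
        2-bounds (inj₁ refl) = 0≤+ 4 , 0≤+ 0
        2-bounds (inj₂ refl) = 0≤+ 0 , 0≤+ 4

        -- The offset is `2s - τ` or its negative, whichever gives `η = |U - 2|V||`. This is nonzero
        -- by `U≢2V`, and less than `U` because `0 < |V| < U`.
        core-U>V : 0ℤ < u′ - s * v → Core q f g
        core-U>V U>V = choose (compare u′ (+ 2 * (s * v)))
          where
          neg-unit : Unit (- s)
          neg-unit = [ (λ { refl → inj₂ refl }) , (λ { refl → inj₁ refl }) ]′ unit

          facet₁ : ∀ B q v U s → 0ℤ ≤ B - ((q - + 1) * U + s * v) → 0ℤ ≤ q - + 2 → 0ℤ < s * v → 0ℤ ≤ U →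
            0ℤ < + 2 * B - q * (+ 2 * - s * v + + 1 * U)
          facet₁ B q v U s h t k k′ = by< 1 (6 ·⁺ k ⊞⁺ 2 · h ⊞ t ⊠ k′ ⊞ 2 · (t ⊠ <⇒≤ k)) (solve (B ∷ q ∷ v ∷ U ∷ s ∷ []))
          facet₂ : ∀ B q v U s → 0ℤ ≤ B - ((q - + 1) * U + s * v) → 0ℤ ≤ q - + 2 → 0ℤ ≤ s * v → 0ℤ < U → 0ℤ < U - s * v →
            0ℤ < + 2 * B - q * (+ 2 * s * v + -1ℤ * U)
          facet₂ B q v U s h t k k′ d = by< 1 (2 ·⁺ k′ ⊞⁺ 2 · h ⊞ t ⊠ <⇒≤ k′ ⊞ 2 · (t ⊠ <⇒≤ d) ⊞ 2 · <⇒≤ d) (solve (B ∷ q ∷ v ∷ U ∷ s ∷ []))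

          η-form₁ : ∀ s v U → U - + 2 * (s * v) ≡ + 1 * (+ 2 * - s * v + + 1 * U)
          η-form₁ = solve-∀
          η-form₂ : ∀ s v U → + 2 * (s * v) - U ≡ + 1 * (+ 2 * s * v + -1ℤ * U)
          η-form₂ = solve-∀

          choose : 0ℤ < u′ - + 2 * (s * v) ⊎ 0ℤ < + 2 * (s * v) - u′ ⊎ u′ ≡ + 2 * (s * v) → Core q f g
          choose (inj₁ d) = let (e , c , h) = large-carry-U ; (l , l′) = 2-bounds neg-unit in
            finish neg-unit (+ 0) c (by< 1 d (η-form₁ s v u′)) (facet₁ (lineB q f g e) q v u′ s h q≥2 sV>0 U≥0)
              (small-shift (+ 2 * - s) (+ 1) l l′ (0≤+ 3) (0≤+ 1))
          choose (inj₂ (inj₁ d)) = let (e , c , h) = large-carry-U ; (l , l′) = 2-bounds unit in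
            finish unit -1ℤ c (by< 1 d (η-form₂ s v u′)) (facet₂ (lineB q f g e) q v u′ s h q≥2 sV≥0 U>0 U>V)
              (small-shift (+ 2 * s) -1ℤ l l′ (0≤+ 1) (0≤+ 3))
          choose (inj₂ (inj₂ eq)) = contradiction eq U≢2V

        -- Odd multiples of `U` are spaced by `2U`. With `r` the remainder of `m` modulo `U`, the
        -- value `η` is `2r - U` if that is positive and `2r + U` otherwise.
        odd-multiple : ∀ m U → 0ℤ < U → Σ ℤ λ b₁ → let η = + 2 * m + (+ 1 + + 2 * b₁) * U in
          0ℤ < η × 0ℤ ≤ + 2 * U - η
        odd-multiple m U@(+[1+ n ]) U>0 = choose (compare (+ 2 * r) U)
          where
          k = m /ℕ suc n
          r = + (m %ℕ suc n)
          r≥0 : 0ℤ ≤ r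
          r≥0 = 0≤+ _
          r<U : 0ℤ < U - r
          r<U = subst (_< U - r) (+-inverseʳ r) (+-monoˡ-< (- r) (+<+ (n%ℕd<d m (suc n))))
          division : m ≡ r + k * U
          division = a≡a%ℕn+[a/ℕn]*n m (suc n)

          below : ∀ k r U → 0ℤ < + 2 * r - U → 0ℤ ≤ U - r → 0ℤ ≤ U →
            let η = + 2 * (r + k * U) + (+ 1 + + 2 * (- k - + 1)) * U in 0ℤ < η × 0ℤ ≤ + 2 * U - η
          below k r U h h′ h″ = by< 1 h (solve (k ∷ r ∷ U ∷ [])) , by≤ 1 (2 · h′ ⊞ h″) (solve (k ∷ r ∷ U ∷ []))
          above : ∀ k r U → 0ℤ ≤ U - + 2 * r → 0ℤ < U → 0ℤ ≤ r →
            let η = + 2 * (r + k * U) + (+ 1 + + 2 * - k) * U in 0ℤ < η × 0ℤ ≤ + 2 * U - η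
          above k r U h h′ h″ = by< 1 (h′ ⊞⁺ 2 · h″) (solve (k ∷ r ∷ U ∷ [])) , by≤ 1 h (solve (k ∷ r ∷ U ∷ []))

          Goal : ℤ → Set
          Goal m = Σ ℤ λ b₁ → let η = + 2 * m + (+ 1 + + 2 * b₁) * U in 0ℤ < η × 0ℤ ≤ + 2 * U - η
          choose : 0ℤ < + 2 * r - U ⊎ 0ℤ < U - + 2 * r ⊎ + 2 * r ≡ U → Goal m
          choose (inj₁ h) = subst Goal (sym division) (- k - + 1 , below k r U h (<⇒≤ r<U) (0≤+ _))
          choose (inj₂ (inj₁ h)) = subst Goal (sym division) (- k , above k r U (<⇒≤ h) U>0 r≥0)
          choose (inj₂ (inj₂ h)) = subst Goal (sym division) (- k , above k r U (≤-reflexive (sym (trans (cong (λ z → U - z) h) (+-inverseʳ U)))) U>0 r≥0)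
        odd-multiple m +0 (+<+ ())

        core-V>U : 0ℤ < s * v - u′ → Core q f g
        core-V>U V>U = let (b₁ , η>0 , η≤2U) = odd-multiple (s * v) u′ U>0
                           (e , c , h) = large-carry-V in
          finish unit b₁ c (by< 1 η>0 (η-form s v u′ (+ 1 + + 2 * b₁)))
            (facet (lineB q f g e) q v u′ s (+ 1 + + 2 * b₁) h q≥2 η≤2U V>U)
            (ζ-small (+ 1 + + 2 * b₁) η>0 η≤2U)
          where
          u>0 : 0ℤ < u
          u>0 = by< 1 (32 ·⁺ 0<1 ⊞⁺ u≥32) (lem u)
            where
            lem : ∀ u → + 32 * + 1 + (u - + 32) ≡ + 1 * u
            lem = solve-∀

          -- Here `m = |V|` and `U = qu`. From `0 < η ≤ 2U` and `m > U` follows `-2m < bU < 0`.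
          -- Multiplication by `m/u` gives `|bqm| ≤ 2m²/u ≤ 8Q/u`, and `u ≥ 32` turns this into
          -- `Q/4`.
          product-small : ∀ Q b q u m → 0ℤ < u → 0ℤ ≤ u - + 32 → 0ℤ ≤ + 4 * Q - m * m → 0ℤ ≤ Q → 0ℤ < m →
            0ℤ < + 2 * m + b * (q * u) → 0ℤ ≤ + 2 * (q * u) - (+ 2 * m + b * (q * u)) → 0ℤ < m - q * u →
            Small 4 Q (b * (q * m))
          product-small Q b q u m u>0 u≥32 m²≤4Q Q≥0 m>0 η>0 η≤2U m>U = small
            (cancel≤ u>0 (by≤ 1 (u≥32 ⊠ Q≥0 ⊞ 32 · Q≥0 ⊞ 4 · ((2 · <⇒≤ m>U ⊞ η≤2U) ⊠ <⇒≤ m>0)) (solve (Q ∷ b ∷ q ∷ u ∷ m ∷ []))))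
            (cancel≤ u>0 (by≤ 1 (u≥32 ⊠ Q≥0 ⊞ 4 · (<⇒≤ η>0 ⊠ <⇒≤ m>0) ⊞ 8 · m²≤4Q) (solve (Q ∷ b ∷ q ∷ u ∷ m ∷ []))))

          unsign : ∀ b → Small 4 Q (b * (q * (s * v))) → Small 4 Q (b * (q * v))
          unsign b h = choose unit
            where
            neg-form : ∀ b q v → b * (q * v) ≡ - (b * (q * (-1ℤ * v)))
            neg-form = solve-∀
            choose : Unit s → Small 4 Q (b * (q * v))
            choose (inj₁ s≡1) = subst (λ x → Small 4 Q (b * (q * x))) (trans (cong (_* v) s≡1) (*-identityˡ v)) h
            choose (inj₂ s≡-1) = Small-neg (subst (λ s → Small 4 Q (b * (q * (s * v)))) s≡-1 h) (neg-form b q v)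

          square-form : 0ℤ ≤ + 4 * Q - s * v * (s * v)
          square-form = subst (0ℤ ≤_) (choose unit) (V²≤4Q q f g q≥2)
            where
            neg-form : ∀ Q v → + 4 * Q - v * v ≡ + 4 * Q - -1ℤ * v * (-1ℤ * v)
            neg-form = solve-∀
            pos-form : ∀ Q v → + 4 * Q - v * v ≡ + 4 * Q - + 1 * v * (+ 1 * v)
            pos-form = solve-∀
            choose : Unit s → + 4 * Q - v * v ≡ + 4 * Q - s * v * (s * v)
            choose (inj₁ s≡1) = trans (pos-form Q v) (cong (λ s → + 4 * Q - s * v * (s * v)) (sym s≡1))
            choose (inj₂ s≡-1) = trans (neg-form Q v) (cong (λ s → + 4 * Q - s * v * (s * v)) (sym s≡-1))

          total-small : ∀ q P a v U Z → 0ℤ ≤ q - + 2 → 0ℤ ≤ P → Small 32 P (a * v) → Small 32 P (a * U) → Small 4 (q * P) Z →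
            Small 2 (q * P) (a * (v - U) + Z)
          total-small q P a v U Z t P≥0 (small x x′) (small y y′) (small z z′) = small
            (by≤ 16 (x ⊞ y′ ⊞ 8 · z ⊞ 8 · (t ⊠ P≥0) ⊞ 14 · P≥0) (solve (q ∷ P ∷ a ∷ v ∷ U ∷ Z ∷ [])))
            (by≤ 16 (x′ ⊞ y ⊞ 8 · z′ ⊞ 8 · (t ⊠ P≥0) ⊞ 14 · P≥0) (solve (q ∷ P ∷ a ∷ v ∷ U ∷ Z ∷ [])))

          ζ-small : ∀ b → 0ℤ < + 2 * (s * v) + b * u′ → 0ℤ ≤ + 2 * u′ - (+ 2 * (s * v) + b * u′) →
            Small 2 Q (+ 2 * s * (v - u′) + b * (q * v))
          ζ-small b η>0 η≤2U = let (l , l′) = 2-bounds unit in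
            total-small q P (+ 2 * s) v u′ (b * (q * v)) q≥2 (<⇒≤ P>0)
              (Small-* P (+ 2 * s) v l l′ sV) (Small-* P (+ 2 * s) u′ l l′ sU)
              (unsign b (product-small Q b q u (s * v) u>0 u≥32 square-form (<⇒≤ (q>0 ⊠⁺ P>0)) sV>0 η>0 η≤2U V>U))

          η-form : ∀ s v U b → + 2 * (s * v) + b * U ≡ + 1 * (+ 2 * s * v + b * U)
          η-form = solve-∀
          facet : ∀ B q v U s b → 0ℤ ≤ B - ((q - + 1) * (s * v) + U) → 0ℤ ≤ q - + 2 → 0ℤ ≤ + 2 * U - (+ 2 * (s * v) + b * U) →
            0ℤ < s * v - U → 0ℤ < + 2 * B - q * (+ 2 * s * v + b * U)
          facet B q v U s b h t k d = by< 1 (2 ·⁺ d ⊞⁺ 2 · h ⊞ t ⊠ k ⊞ 2 · k ⊞ 2 · (t ⊠ <⇒≤ d)) (solve (B ∷ q ∷ v ∷ U ∷ s ∷ b ∷ []))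

        core : Core q f g
        core = choose (compare u′ (s * v))
          where
          choose : 0ℤ < u′ - s * v ⊎ 0ℤ < s * v - u′ ⊎ u′ ≡ s * v → Core q f g
          choose (inj₁ h) = core-U>V h
          choose (inj₂ (inj₁ h)) = core-V>U h
          choose (inj₂ (inj₂ U≡V)) = contradiction (divides u (trans (sym U≡V) (*-comm q u))) q∤sV

  -- Parities and signs

  Even Odd : ℤ → Set
  Even x = Σ ℤ λ k → x ≡ + 2 * k
  Odd x = Σ ℤ λ k → x ≡ + 1 + + 2 * k

  even⊎odd : ∀ x → Even x ⊎ Odd x
  even⊎odd x = let (k , h) = floor-half x in [ inj₁ ∘ (k ,_) , inj₂ ∘ (k ,_) ]′ h

  even-neg : ∀ {x} → Even x → Even (- x)
  even-neg (k , refl) = - k , lem k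
    where
    lem : ∀ k → - (+ 2 * k) ≡ + 2 * - k
    lem = solve-∀

  odd-neg : ∀ {x} → Odd x → Odd (- x)
  odd-neg (k , refl) = - k - + 1 , lem k
    where
    lem : ∀ k → - (+ 1 + + 2 * k) ≡ + 1 + + 2 * (- k - + 1)
    lem = solve-∀

  odd+odd : ∀ {x y} → Odd x → Odd y → Even (x + y)
  odd+odd (k , refl) (l , refl) = + 1 + k + l , lem k l
    where
    lem : ∀ k l → + 1 + + 2 * k + (+ 1 + + 2 * l) ≡ + 2 * (+ 1 + k + l)
    lem = solve-∀

  odd+even : ∀ {x y} → Odd x → Even y → Odd (x + y)
  odd+even (k , refl) (l , refl) = k + l , lem k l
    where
    lem : ∀ k l → + 1 + + 2 * k + + 2 * l ≡ + 1 + + 2 * (k + l)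
    lem = solve-∀

  even+odd : ∀ {x y} → Even x → Odd y → Odd (x + y)
  even+odd {x} {y} h k = subst Odd (+-comm y x) (odd+even k h)

  odd*odd : ∀ {x y} → Odd x → Odd y → Odd (x * y)
  odd*odd (k , refl) (l , refl) = k + l + + 2 * (k * l) , lem k l
    where
    lem : ∀ k l → (+ 1 + + 2 * k) * (+ 1 + + 2 * l) ≡ + 1 + + 2 * (k + l + + 2 * (k * l))
    lem = solve-∀

  *-even : ∀ x {y} → Even y → Even (x * y)
  *-even x (l , refl) = x * l , lem x l
    where
    lem : ∀ x l → x * (+ 2 * l) ≡ + 2 * (x * l)
    lem = solve-∀

  even-∣ : ∀ {q x} → Even q → q ∣ x → Even x
  even-∣ q-even (divides k refl) = *-even k q-even

  unit-odd : ∀ {p} → Unit p → Odd p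
  unit-odd (inj₁ refl) = + 0 , refl
  unit-odd (inj₂ refl) = -1ℤ , refl

  -- The trace bound is attached to the one class in which the offset may be long.
  data Parities (q f g : ℤ) : Set where
    even-q    : Even q → Even f → Odd g → Parities q f g
    odd-odd   : Odd q → Odd f → Odd g → Parities q f g
    even-odd  : Odd q → Even f → Odd g → Parities q f g
    odd-even  : Odd q → Odd f → Even g → 32 ℕ.≤ ∣ + 2 * f + g ∣ → Parities q f g

  Parities-neg : ∀ {q f g} → Parities q f g → Parities q (- f) (- g)
  Parities-neg (even-q h k l) = even-q h (even-neg k) (odd-neg l)
  Parities-neg (odd-odd h k l) = odd-odd h (odd-neg k) (odd-neg l)
  Parities-neg (even-odd h k l) = even-odd h (even-neg k) (odd-neg l)
  Parities-neg {q} {f} {g} (odd-even h k l b) = odd-even h (odd-neg k) (even-neg l)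
    (subst (32 ℕ.≤_) (trans (sym (∣-i∣≡∣i∣ (+ 2 * f + g))) (cong ∣_∣ (lem f g))) b)
    where
    lem : ∀ f g → - (+ 2 * f + g) ≡ + 2 * - f + - g
    lem = solve-∀

  Reduced-neg : ∀ {q f g} → Reduced q f g → Reduced q (- f) (- g)
  Reduced-neg {q} {f} {g} red = record
    { q≥2 = q≥2
    ; P>0 = subst (0ℤ <_) P-neg P>0
    ; q∣f = ∣m⇒∣-m q∣f
    ; q∤g = λ h → q∤g (subst (q ∣_) (neg-involutive g) (∣m⇒∣-m h))
    ; sV = neg-small (V-neg q f g) sV
    ; sU = neg-small (U-neg q f g) sU
    ; sqV = neg-small (qV-neg q f g) sqV
    ; sqU = neg-small (qU-neg q f g) sqU
    }
    where
    open Reduced red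
    N-neg : ∀ q f g → N₁ q f g ≡ N₁ q (- f) (- g)
    N-neg = NR.solve 3 (λ q f g → normᴱ 1ᴱ q (f , g) , normᴱ 1ᴱ q (⊝ f , ⊝ g)) refl
    P-neg = N-neg q f g
    V-neg : ∀ q f g → V q (- f) (- g) ≡ - V q f g
    V-neg = NR.solve 3 (λ q f g → Vᴱ q (⊝ f) (⊝ g) , ⊝ Vᴱ q f g) refl
    U-neg : ∀ q f g → U q (- f) (- g) ≡ - U q f g
    U-neg = NR.solve 3 (λ q f g → Uᴱ q (⊝ f) (⊝ g) , ⊝ Uᴱ q f g) refl
    qV-neg : ∀ q f g → q * V q (- f) (- g) ≡ - (q * V q f g)
    qV-neg = NR.solve 3 (λ q f g → q ⊗ Vᴱ q (⊝ f) (⊝ g) , ⊝ (q ⊗ Vᴱ q f g)) refl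
    qU-neg : ∀ q f g → q * U q (- f) (- g) ≡ - (q * U q f g)
    qU-neg = NR.solve 3 (λ q f g → q ⊗ Uᴱ q (⊝ f) (⊝ g) , ⊝ (q ⊗ Uᴱ q f g)) refl
    neg-small : ∀ {X Y} → Y ≡ - X → Small 64 (N₁ q f g) X → Small 64 (N₁ q (- f) (- g)) Y
    neg-small {Y = Y} eq h = subst (λ P → Small 64 P Y) P-neg (Small-neg h eq)

  Good-flip : ∀ {q f g} z → Good q (- f) (- g) z → Good q f g z
  Good-flip {q} {f} {g} (a , b) (good i d) = good
    (Inside-neg q (q * N₁ q f g) A B (subst (λ P → Inside q (q * P) A B) (N-neg q f g) i) (A-neg q f g a b) (B-neg q f g a b)) d
    where
    A = lineA q (- f) (- g) (a , b)
    B = lineB q (- f) (- g) (a , b)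
    N-neg : ∀ q f g → N₁ q (- f) (- g) ≡ N₁ q f g
    N-neg = NR.solve 3 (λ q f g → normᴱ 1ᴱ q (⊝ f , ⊝ g) , normᴱ 1ᴱ q (f , g)) refl
    A-neg : ∀ q f g a b → lineA q f g (a , b) ≡ - lineA q (- f) (- g) (a , b)
    A-neg = NR.solve 5 (λ q f g a b → lineAᴱ q f g (a , b) , ⊝ lineAᴱ q (⊝ f) (⊝ g) (a , b)) refl
    B-neg : ∀ q f g a b → lineB q f g (a , b) ≡ - lineB q (- f) (- g) (a , b)
    B-neg = NR.solve 5 (λ q f g a b → lineBᴱ q f g (a , b) , ⊝ lineBᴱ q (⊝ f) (⊝ g) (a , b)) refl

  Good-neg : ∀ {q f g} z → Good q f g z → Good q f g (negτ z)
  Good-neg {q} {f} {g} (a , b) (good i d) = good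
    (Inside-neg q (q * N₁ q f g) _ _ i (A-neg (V q f g) (U q f g) a b) (A-neg (V q f g - U q f g) (q * V q f g) a b))
    (λ h → d (subst (q ∣_) (neg-involutive a) (∣m⇒∣-m h)))
    where
    A-neg : ∀ v U a b → - a * v + - b * U ≡ - (a * v + b * U)
    A-neg = solve-∀

  -- Passing from `ω₁` to `-ω₁` also negates `ω` but keeps `ω²`. Hence the digits multiplied by `ω₁`
  -- or `ω` change sign and the constant digits stay.
  Core-flip : ∀ {q f g} → Core q (- f) (- g) → Core q f g
  Core-flip {q} {f} {g} core = record
    { d₁ = d₁ ; d₂ = negτ d₂ ; c = c ; r = negτ r
    ; good-d₁ = Good-flip d₁ good-d₁
    ; good-d₂ = Good-neg d₂ (Good-flip d₂ good-d₂)
    ; good-c = Good-flip c good-c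
    ; good-r = Good-neg r (Good-flip r good-r)
    ; carry = trans (sym (cong₂ _,_ (low₁ q f g (proj₁ d₁) (proj₁ d₂) (proj₂ d₂)) (low₂ q f g (proj₂ d₁) (proj₁ d₂) (proj₂ d₂))))
        (trans carry (cong₂ _,_ (high₁ q f g (proj₁ c) (proj₁ r) (proj₂ r)) (high₂ q f g (proj₂ c) (proj₁ r) (proj₂ r))))
    }
    where
    open Core core
    low₁ : ∀ q f g a x y → a + proj₁ (mulτ (+ 1) q (- f , - g) (x , y)) ≡ a + proj₁ (mulτ (+ 1) q (f , g) (negτ (x , y)))
    low₁ = NR.solve 6 (λ q f g a x y → a ⊕ proj₁ (mulᴱ 1ᴱ q (⊝ f , ⊝ g) (x , y)) , a ⊕ proj₁ (mulᴱ 1ᴱ q (f , g) (⊝ x , ⊝ y))) refl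
    low₂ : ∀ q f g a x y → a + proj₂ (mulτ (+ 1) q (- f , - g) (x , y)) ≡ a + proj₂ (mulτ (+ 1) q (f , g) (negτ (x , y)))
    low₂ = NR.solve 6 (λ q f g a x y → a ⊕ proj₂ (mulᴱ 1ᴱ q (⊝ f , ⊝ g) (x , y)) , a ⊕ proj₂ (mulᴱ 1ᴱ q (f , g) (⊝ x , ⊝ y))) refl
    high₁ : ∀ q f g a x y → let ω′ = mulτ (+ 1) q tauτ (- f , - g) ; ω = mulτ (+ 1) q tauτ (f , g) in
      a + proj₁ (mulτ (+ 1) q ω′ (addτ (x , y) ω′)) ≡ a + proj₁ (mulτ (+ 1) q ω (addτ (negτ (x , y)) ω))
    high₁ = NR.solve 6 (λ q f g a x y → let ω′ = mulᴱ 1ᴱ q tauᴱ (⊝ f , ⊝ g) ; ω = mulᴱ 1ᴱ q tauᴱ (f , g) in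
      a ⊕ proj₁ (mulᴱ 1ᴱ q ω′ (addᴱ (x , y) ω′)) , a ⊕ proj₁ (mulᴱ 1ᴱ q ω (addᴱ (⊝ x , ⊝ y) ω))) refl
    high₂ : ∀ q f g a x y → let ω′ = mulτ (+ 1) q tauτ (- f , - g) ; ω = mulτ (+ 1) q tauτ (f , g) in
      a + proj₂ (mulτ (+ 1) q ω′ (addτ (x , y) ω′)) ≡ a + proj₂ (mulτ (+ 1) q ω (addτ (negτ (x , y)) ω))
    high₂ = NR.solve 6 (λ q f g a x y → let ω′ = mulᴱ 1ᴱ q tauᴱ (⊝ f , ⊝ g) ; ω = mulᴱ 1ᴱ q tauᴱ (f , g) in
      a ⊕ proj₂ (mulᴱ 1ᴱ q ω′ (addᴱ (x , y) ω′)) , a ⊕ proj₂ (mulᴱ 1ᴱ q ω (addᴱ (⊝ x , ⊝ y) ω))) refl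

  core-positive : ∀ {q f g} → Reduced q f g → 0ℤ < + 2 * f + g → Parities q f g → Core q f g
  core-positive {q} {f} {g} red u>0 = choose
    where
    open Reduced red
    V≢0 : V q f g ≢ 0ℤ
    V≢0 eq = q∤V red (divides (+ 0) eq)
    sign-V = unit-sign (V q f g) V≢0
    open Shifts red (positive-from-2 q q≥2 ⊠⁺ u>0) (proj₁ (proj₂ sign-V)) (proj₂ (proj₂ sign-V))

    bound : ∀ u → 0ℤ < u → 32 ℕ.≤ ∣ u ∣ → 0ℤ ≤ u - + 32
    bound (+ n) _ h = i≤j⇒0≤j-i (+≤+ h)
    bound -[1+ n ] ()

    choose : Parities q f g → Core q f g
    choose (even-q (q₁ , q-even) (f₁ , f-even) (g₁ , g-odd)) = core-even-q q₁ f₁ g₁ q-even f-even g-odd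
    choose (odd-odd (q₁ , q-odd) (f₁ , f-odd) (g₁ , g-odd)) = OddQ.OddG.core-odd-f q₁ q-odd g₁ g-odd f₁ f-odd
    choose (even-odd (q₁ , q-odd) (f₁ , f-even) (g₁ , g-odd)) = OddQ.OddG.core-even-f q₁ q-odd g₁ g-odd f₁ f-even
    choose (odd-even (q₁ , q-odd) (f₁ , f-odd) (g₁ , g-even) h) =
      OddQ.EvenG.core q₁ q-odd g₁ g-even f₁ f-odd (bound (+ 2 * f + g) u>0 h)

  core-exists : ∀ {q f g} → Reduced q f g → Parities q f g → Core q f g
  core-exists {q} {f} {g} red par with <-cmp 0ℤ (+ 2 * f + g)
  ... | tri< u>0 _ _ = core-positive red u>0 par
  ... | tri≈ _ u≡0 _ = contradiction (divides-g (sym u≡0)) q∤g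
    where
    open Reduced red
    divides-g : + 2 * f + g ≡ 0ℤ → q ∣ g
    divides-g eq = ∣m+n∣m⇒∣n (subst (q ∣_) (sym eq) (divides (+ 0) refl)) (∣n⇒∣m*n (+ 2) q∣f)
  ... | tri> _ _ u<0 = Core-flip (core-positive (Reduced-neg red)
      (subst (0ℤ <_) (lem f g) (neg-mono-< u<0)) (Parities-neg par))
    where
    lem : ∀ f g → - (+ 2 * f + g) ≡ + 2 * - f + - g
    lem = solve-∀

  -- Powers of τ

  norm-mul : ∀ p q x y → normτ p q (mulτ p q x y) ≡ normτ p q x * normτ p q y
  norm-mul p q (a , b) (c , d) = lem p q a b c d
    where
    lem : ∀ p q a b c d → normτ p q (mulτ p q (a , b) (c , d)) ≡ normτ p q (a , b) * normτ p q (c , d)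
    lem = NR.solve 6 (λ p q a b c d → normᴱ p q (mulᴱ p q (a , b) (c , d)) , normᴱ p q (a , b) ⊗ normᴱ p q (c , d)) refl

  norm-τ : ∀ p q → normτ p q tauτ ≡ q
  norm-τ = NR.solve 2 (λ p q → normᴱ p q tauᴱ , q) refl

  norm-pow : ∀ p q n → normτ p (+ q) (powτ p (+ q) tauτ n) ≡ + (q ℕ.^ n)
  norm-pow p q zero = lem p (+ q)
    where
    lem : ∀ p q → normτ p q oneτ ≡ + 1
    lem = NR.solve 2 (λ p q → normᴱ p q (1ᴱ , Κ (+ 0)) , 1ᴱ) refl
  norm-pow p q (suc n) = trans (norm-mul p (+ q) tauτ (powτ p (+ q) tauτ n))
    (trans (cong₂ _*_ (norm-τ p (+ q)) (norm-pow p q n)) (sym (pos-* q (q ℕ.^ n))))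

  square-bound : ∀ P x → 0ℤ ≤ P → 0ℤ ≤ P * P - x * x → 0ℤ ≤ P - x
  square-bound P x P≥0 h with compare x P
  ... | inj₁ x>P = contradiction (by< 1 (x>P ⊠⁺ x>P ⊞⁺ 2 · (P≥0 ⊠ <⇒≤ x>P) ⊞ h) (lem P x)) (<-irrefl refl)
    where
    lem : ∀ P x → (x - P) * (x - P) + (+ 2 * (P * (x - P)) + (P * P - x * x)) ≡ + 1 * + 0
    lem = solve-∀
  ... | inj₂ (inj₁ x<P) = <⇒≤ x<P
  ... | inj₂ (inj₂ refl) = ≤-reflexive (sym (+-inverseʳ P))

  square-small : ∀ P x → 0ℤ ≤ P → 0ℤ ≤ P * P - + 64 * x * (+ 64 * x) → Small 64 P x
  square-small P x P≥0 h = small (square-bound P (+ 64 * x) P≥0 h)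
    (subst (λ y → 0ℤ ≤ P + y) (neg-involutive (+ 64 * x)) (square-bound P (- (+ 64 * x)) P≥0 (subst (λ y → 0ℤ ≤ P * P - y) (lem x) h)))
    where
    lem : ∀ x → + 64 * x * (+ 64 * x) ≡ - (+ 64 * x) * - (+ 64 * x)
    lem = solve-∀

  Small-cancel : ∀ q P x → 0ℤ ≤ q - + 2 → 0ℤ ≤ P → Small 64 P (q * x) → Small 64 P x
  Small-cancel q P x q≥2 P≥0 (small h h′) = small
    (cancel≤ (positive-from-2 q q≥2) (by≤ 1 (h ⊞ q≥2 ⊠ P≥0 ⊞ P≥0) (solve (q ∷ P ∷ x ∷ []))))
    (cancel≤ (positive-from-2 q q≥2) (by≤ 1 (h′ ⊞ q≥2 ⊠ P≥0 ⊞ P≥0) (solve (q ∷ P ∷ x ∷ []))))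

  -- With `|Tr ω|² ≤ 4qP` and `|Tr ω₁|² ≤ 4P`, both squares are at most `4c²q⁴P`, hence at most
  -- `P²`. The exponent 4 is forced by `qU = q² Tr ω₁`.
  module _ (c q P : ℤ) (c≥0 : 0ℤ ≤ c) (q≥2 : 0ℤ ≤ q - + 2) (P≥0 : 0ℤ ≤ P)
    (P-large : 0ℤ ≤ P - + 4 * (c * c) * (q * q * q * q)) where

    private
      q≥0 = <⇒≤ (positive-from-2 q q≥2)
      c²≥0 = c≥0 ⊠ c≥0
      q²≥0 = q≥0 ⊠ q≥0

    square-V : ∀ v → 0ℤ ≤ + 4 * (q * P) - v * v → 0ℤ ≤ P * P - c * (q * v) * (c * (q * v))
    square-V v h = by≤ 1
      (P≥0 ⊠ P-large ⊞ c²≥0 ⊠ q²≥0 ⊠ h ⊞ 4 · (c²≥0 ⊠ q²≥0 ⊠ q≥0 ⊠ P≥0 ⊠ (q≥2 ⊞ 0≤+ 1)))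
      (solve (c ∷ q ∷ P ∷ v ∷ []))

    square-U : ∀ u → 0ℤ ≤ + 4 * P - u * u → 0ℤ ≤ P * P - c * (q * (q * u)) * (c * (q * (q * u)))
    square-U u h = by≤ 1 (P≥0 ⊠ P-large ⊞ c²≥0 ⊠ (q²≥0 ⊠ q²≥0) ⊠ h) (solve (c ∷ q ∷ P ∷ u ∷ []))

  -- a + bτ = a + (pb)(pτ), and pτ is a root of X² - X + q.
  twist : ℤ → Zτ → Zτ
  twist p (a , b) = a , p * b

  module Powers (q : ℕ) (q≥2 : 0ℤ ≤ + q - + 2) (p : ℤ) (unit-p : Unit p) where

    q≥2ℕ : 2 ℕ.≤ q
    q≥2ℕ = drop‿+≤+ (0≤i-j⇒j≤i q≥2)

    τ^ : ℕ → Zτ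
    τ^ = powτ p (+ q) tauτ

    X Y : ℕ → ℤ
    X n = proj₁ (τ^ n)
    Y n = proj₂ (τ^ n)

    X-suc : ∀ n → X (suc n) ≡ - (+ q * Y n)
    X-suc n = lem (+ q) (X n) (Y n)
      where
      lem : ∀ q x y → + 0 * x - q * (+ 1 * y) ≡ - (q * y)
      lem = solve-∀

    Y-suc : ∀ n → Y (suc n) ≡ X n + p * Y n
    Y-suc n = lem p (X n) (Y n)
      where
      lem : ∀ p x y → + 0 * y + + 1 * x + p * (+ 1 * y) ≡ x + p * y
      lem = solve-∀

    q∣X : ∀ n → + q ∣ X (suc n)
    q∣X n = divides (- Y n) (trans (X-suc n) (lem (+ q) (Y n)))
      where
      lem : ∀ q y → - (q * y) ≡ - y * q
      lem = solve-∀

    -- Modulo `q` the recursion reads `Y (n + 1) = p * Y n` once `n ≥ 1`, and `p² = 1`.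
    q∣Y²-1 : ∀ n → + q ∣ Y (suc n) * Y (suc n) - + 1
    q∣Y²-1 zero = subst (+ q ∣_) (sym (trans (cong (λ y → y * y - + 1) (Y-suc 0)) (one unit-p))) (divides (+ 0) refl)
      where
      one : ∀ {p} → Unit p → (+ 1 + p * + 0) * (+ 1 + p * + 0) - + 1 ≡ + 0
      one (inj₁ refl) = refl
      one (inj₂ refl) = refl
    q∣Y²-1 (suc n) = subst (+ q ∣_)
      (trans (square unit-p (X (suc n)) (Y (suc n))) (cong (λ y → y * y - + 1) (sym (Y-suc (suc n)))))
      (∣m∣n⇒∣m+n (∣m⇒∣m*n (X (suc n) + + 2 * p * Y (suc n)) (q∣X n)) (q∣Y²-1 n))
      where
      square₊ : ∀ x y → x * (x + + 2 * + 1 * y) + (y * y - + 1) ≡ (x + + 1 * y) * (x + + 1 * y) - + 1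
      square₊ = solve-∀
      square₋ : ∀ x y → x * (x + + 2 * -1ℤ * y) + (y * y - + 1) ≡ (x + -1ℤ * y) * (x + -1ℤ * y) - + 1
      square₋ = solve-∀
      square : ∀ {p} → Unit p → ∀ x y → x * (x + + 2 * p * y) + (y * y - + 1) ≡ (x + p * y) * (x + p * y) - + 1
      square (inj₁ refl) = square₊
      square (inj₂ refl) = square₋

    q∤Y² : ∀ n → ¬ + q ∣ Y (suc n) * Y (suc n)
    q∤Y² n h = ∤1 q≥2 (subst (+ q ∣_) (lem (Y (suc n) * Y (suc n))) (∣m∣n⇒∣m-n h (q∣Y²-1 n)))
      where
      lem : ∀ x → x - (x - + 1) ≡ + 1
      lem = solve-∀

    q∤pY : ∀ n → ¬ + q ∣ p * Y (suc n)
    q∤pY n h = q∤Y² n (∣n⇒∣m*n (Y (suc n)) (subst (+ q ∣_) (pp unit-p (Y (suc n))) (∣n⇒∣m*n p h)))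
      where
      pp : ∀ {p} → Unit p → ∀ y → p * (p * y) ≡ y
      pp (inj₁ refl) = solve-∀
      pp (inj₂ refl) = solve-∀

    norm-twist : ∀ n → N₁ (+ q) (X n) (p * Y n) ≡ + (q ℕ.^ n)
    norm-twist n = trans (lem unit-p (+ q) (X n) (Y n)) (norm-pow p q n)
      where
      lem : ∀ {p} → Unit p → ∀ q x y → normτ (+ 1) q (x , p * y) ≡ normτ p q (x , y)
      lem (inj₁ refl) = NR.solve 3 (λ q x y → normᴱ 1ᴱ q (x , 1ᴱ ⊗ y) , normᴱ 1ᴱ q (x , y)) refl
      lem (inj₂ refl) = NR.solve 3 (λ q x y → normᴱ 1ᴱ q (x , -1ᴱ ⊗ y) , normᴱ -1ᴱ q (x , y)) refl

    -- For odd `q`, `τ² = τ + 1` modulo 2, so `τ` has order 3 in the field with four elements.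
    data PowerParity (n : ℕ) : Set where
      residue₀ : ∀ k → n ≡ k ℕ.* 3 → Odd (X n) → Even (Y n) → PowerParity n
      residue₁ : ∀ k → n ≡ 1 ℕ.+ k ℕ.* 3 → Even (X n) → Odd (Y n) → PowerParity n
      residue₂ : ∀ k → n ≡ 2 ℕ.+ k ℕ.* 3 → Odd (X n) → Odd (Y n) → PowerParity n

    power-parity : Odd (+ q) → ∀ n → PowerParity n
    power-parity q-odd zero = residue₀ 0 refl (+ 0 , refl) (+ 0 , refl)
    power-parity q-odd (suc n) = step (power-parity q-odd n)
      where
      Y-parity : ∀ (P : ℤ → Set) → P (X n + p * Y n) → P (Y (suc n))
      Y-parity P = subst P (sym (Y-suc n))
      X-parity : ∀ (P : ℤ → Set) → P (- (+ q * Y n)) → P (X (suc n))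
      X-parity P = subst P (sym (X-suc n))
      step : PowerParity n → PowerParity (suc n)
      step (residue₀ k eq x y) = residue₁ k (cong suc eq)
        (X-parity Even (even-neg (*-even (+ q) y))) (Y-parity Odd (odd+even x (*-even p y)))
      step (residue₁ k eq x y) = residue₂ k (cong suc eq)
        (X-parity Odd (odd-neg (odd*odd q-odd y))) (Y-parity Odd (even+odd x (odd*odd (unit-odd unit-p) y)))
      step (residue₂ k eq x y) = residue₀ (suc k) (cong suc eq)
        (X-parity Odd (odd-neg (odd*odd q-odd y))) (Y-parity Even (odd+odd x (odd*odd (unit-odd unit-p) y)))

    cube : Zτ → Zτ
    cube z = mulτ p (+ q) z (mulτ p (+ q) z z)

    pow-cube : ∀ k → τ^ (k ℕ.* 3) ≡ cube (τ^ k)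
    pow-cube zero = cong₂ _,_ (lem₁ p (+ q)) (lem₂ p (+ q))
      where
      oneᴱ : ∀ {n} → Expr ℤ n × Expr ℤ n
      oneᴱ = 1ᴱ , Κ (+ 0)
      lem₁ : ∀ p q → + 1 ≡ proj₁ (mulτ p q oneτ (mulτ p q oneτ oneτ))
      lem₁ = NR.solve 2 (λ p q → 1ᴱ , proj₁ (mulᴱ p q oneᴱ (mulᴱ p q oneᴱ oneᴱ))) refl
      lem₂ : ∀ p q → + 0 ≡ proj₂ (mulτ p q oneτ (mulτ p q oneτ oneτ))
      lem₂ = NR.solve 2 (λ p q → Κ (+ 0) , proj₂ (mulᴱ p q oneᴱ (mulᴱ p q oneᴱ oneᴱ))) refl
    pow-cube (suc k) = trans (cong (λ z → mulτ p (+ q) tauτ (mulτ p (+ q) tauτ (mulτ p (+ q) tauτ z))) (pow-cube k))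
      (cong₂ _,_ (lem₁ p (+ q) (X k) (Y k)) (lem₂ p (+ q) (X k) (Y k)))
      where
      lem₁ : ∀ p q x y → let m = mulτ p q ; z = (x , y) in
        proj₁ (m tauτ (m tauτ (m tauτ (m z (m z z))))) ≡ proj₁ (m (m tauτ z) (m (m tauτ z) (m tauτ z)))
      lem₁ = NR.solve 4 (λ p q x y → let m = mulᴱ p q ; z = (x , y) in
        proj₁ (m tauᴱ (m tauᴱ (m tauᴱ (m z (m z z))))) , proj₁ (m (m tauᴱ z) (m (m tauᴱ z) (m tauᴱ z)))) refl
      lem₂ : ∀ p q x y → let m = mulτ p q ; z = (x , y) in
        proj₂ (m tauτ (m tauτ (m tauτ (m z (m z z))))) ≡ proj₂ (m (m tauτ z) (m (m tauτ z) (m tauτ z)))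
      lem₂ = NR.solve 4 (λ p q x y → let m = mulᴱ p q ; z = (x , y) in
        proj₂ (m tauᴱ (m tauᴱ (m tauᴱ (m z (m z z))))) , proj₂ (m (m tauᴱ z) (m (m tauᴱ z) (m tauᴱ z)))) refl

    trace : ℕ → ℤ
    trace n = + 2 * X n + p * Y n

    q∤trace² : ∀ n → ¬ + q ∣ trace (suc n) * trace (suc n)
    q∤trace² n h = q∤Y² n (∣m+n∣m⇒∣n (subst (+ q ∣_) (lem unit-p (X (suc n)) (Y (suc n))) h)
      (∣m⇒∣m*n (+ 4 * X (suc n) + + 4 * p * Y (suc n)) (q∣X n)))
      where
      lem : ∀ {p} → Unit p → ∀ x y → (+ 2 * x + p * y) * (+ 2 * x + p * y) ≡ x * (+ 4 * x + + 4 * p * y) + y * y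
      lem (inj₁ refl) = solve-∀
      lem (inj₂ refl) = solve-∀

    -- Expand `(z + z̄)³ = z³ + z̄³ + 3 z z̄ (z + z̄)` for `z = τ^k`.
    trace-cube : ∀ k → trace (k ℕ.* 3) ≡ trace k * (trace k * trace k - + 3 * + (q ℕ.^ k))
    trace-cube k = trans (cong (λ z → + 2 * proj₁ z + p * proj₂ z) (pow-cube k))
      (trans (lem p (+ q) (X k) (Y k)) (cong (λ N → trace k * (trace k * trace k - + 3 * N)) (norm-pow p q k)))
      where
      lem : ∀ p q x y → let m = mulτ p q ; z = (x , y) ; c = m z (m z z) ; t = + 2 * x + p * y in
        + 2 * proj₁ c + p * proj₂ c ≡ t * (t * t - + 3 * normτ p q z)
      lem = NR.solve 4 (λ p q x y → let m = mulᴱ p q ; z = (x , y) ; c = m z (m z z) ; t = 2ᴱ ⊗ x ⊕ p ⊗ y in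
        2ᴱ ⊗ proj₁ c ⊕ p ⊗ proj₂ c , t ⊗ (t ⊗ t ⊖ Κ (+ 3) ⊗ normᴱ p q z)) refl

    -- Neither factor `m` nor `m² - 3q^k` vanishes, because `q` does not divide `m²`. If `|m| < 32`,
    -- then `q^k ≥ 1024` makes the second factor at least `3 * 1024 - 1024` in absolute value; so
    -- one factor always reaches 32.
    trace-large : ∀ k → 10 ℕ.≤ k → 32 ℕ.≤ ∣ trace (k ℕ.* 3) ∣
    trace-large (suc k) 10≤k = subst (λ t → 32 ℕ.≤ ∣ t ∣) (sym (trace-cube (suc k)))
      (subst (32 ℕ.≤_) (sym (abs-* m y)) (product (ℕ._≤?_ 32 ∣ m ∣)))
      where
      m = trace (suc k)
      R = q ℕ.^ suc k
      y = m * m - + 3 * + R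

      q∣R : + q ∣ + R
      q∣R = divides (+ (q ℕ.^ k)) (trans (pos-* q (q ℕ.^ k)) (*-comm (+ q) (+ (q ℕ.^ k))))

      m²≢0 : ¬ + q ∣ m * m
      m²≢0 = q∤trace² k

      ∣m∣≥1 : 1 ℕ.≤ ∣ m ∣
      ∣m∣≥1 = ℕ.n≢0⇒n>0 (λ eq → m²≢0 (subst (λ m → + q ∣ m * m) (sym (∣i∣≡0⇒i≡0 {m} eq)) (divides (+ 0) refl)))

      ∣y∣≥1 : 1 ℕ.≤ ∣ y ∣
      ∣y∣≥1 = ℕ.n≢0⇒n>0 (λ eq → m²≢0 (subst (+ q ∣_) (sym (i-j≡0⇒i≡j (m * m) (+ 3 * + R) (∣i∣≡0⇒i≡0 {y} eq))) (∣n⇒∣m*n (+ 3) q∣R)))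

      R≥1024 : 1024 ℕ.≤ R
      R≥1024 = ℕ.≤-trans (ℕ.^-monoʳ-≤ 2 10≤k) (ℕ.^-monoˡ-≤ (suc k) q≥2ℕ)

      product : Dec (32 ℕ.≤ ∣ m ∣) → 32 ℕ.≤ ∣ m ∣ ℕ.* ∣ y ∣
      product (yes h) = ℕ.*-mono-≤ h ∣y∣≥1
      product (no h) = ℕ.*-mono-≤ ∣m∣≥1 (ℕ.≮⇒≥ (λ y<32 → ℕ.<⇒≱ (bound y<32) (ℕ.*-monoʳ-≤ 3 R≥1024)))
        where
        bound : ∣ y ∣ ℕ.< 32 → 3 ℕ.* R ℕ.< 3072
        bound y<32 = begin-strict
          3 ℕ.* R ≡⟨ abs-* (+ 3) (+ R) ⟨
          ∣ + 3 * + R ∣ ≡⟨ cong ∣_∣ (lem (m * m) (+ 3 * + R)) ⟩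
          ∣ m * m - y ∣ ≤⟨ ∣i-j∣≤∣i∣+∣j∣ (m * m) y ⟩
          ∣ m * m ∣ ℕ.+ ∣ y ∣ ≡⟨ cong (ℕ._+ ∣ y ∣) (abs-* m m) ⟩
          ∣ m ∣ ℕ.* ∣ m ∣ ℕ.+ ∣ y ∣ <⟨ ℕ.+-mono-≤-< (ℕ.*-mono-≤ (ℕ.≰⇒≥ h) (ℕ.≰⇒≥ h)) y<32 ⟩
          32 ℕ.* 32 ℕ.+ 32 ≤⟨ ℕ.≤ᵇ⇒≤ 1056 3072 _ ⟩
          3072 ∎
          where
          open ℕ.≤-Reasoning
          lem : ∀ x y → y ≡ x - (x - y)
          lem = solve-∀

    q⁴-form : + (q ℕ.^ 4) ≡ + q * + q * + q * + q
    q⁴-form = trans (pos-* q (q ℕ.^ 3)) (trans (cong (+ q *_) (trans (pos-* q (q ℕ.^ 2))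
      (cong (+ q *_) (trans (pos-* q (q ℕ.^ 1)) (cong (+ q *_) (pos-* q 1)))))) (lem (+ q)))
      where
      lem : ∀ q → q * (q * (q * (q * + 1))) ≡ q * q * q * q
      lem = solve-∀

    power-large : ∀ n → 18 ℕ.≤ n → 0ℤ ≤ + (q ℕ.^ n) - + 4 * (+ 64 * + 64) * (+ q * + q * + q * + q)
    power-large n 18≤n = i≤j⇒0≤j-i (subst (_≤ + (q ℕ.^ n)) (trans (pos-* 16384 (q ℕ.^ 4)) (cong (+ 16384 *_) q⁴-form)) (+≤+ bound))
      where
      instance
        q≢0 : ℕ.NonZero q
        q≢0 = ℕ.>-nonZero (ℕ.≤-trans (s≤s z≤n) q≥2ℕ)
      -- `4 * 64² = 2^14 ≤ q^14`, and `18 = 14 + 4`.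
      bound : 16384 ℕ.* q ℕ.^ 4 ℕ.≤ q ℕ.^ n
      bound = ℕ.≤-trans (ℕ.*-monoˡ-≤ (q ℕ.^ 4) (ℕ.^-monoˡ-≤ 14 q≥2ℕ))
        (ℕ.≤-trans (ℕ.≤-reflexive (sym (ℕ.^-distribˡ-+-* q 14 4))) (ℕ.^-monoʳ-≤ q 18≤n))

    reduced : ∀ n → 18 ℕ.≤ n → Reduced (+ q) (X n) (p * Y n)
    reduced (suc n) 18≤n = record
      { q≥2 = q≥2 ; P>0 = P>0 ; q∣f = q∣X n ; q∤g = q∤pY n
      ; sV = Small-cancel (+ q) P v q≥2 P≥0 sqV ; sU = Small-cancel (+ q) P u′ q≥2 P≥0 sqU ; sqV = sqV ; sqU = sqU }
      where
      f = X (suc n)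
      g = p * Y (suc n)
      P = N₁ (+ q) f g
      v = V (+ q) f g
      u′ = U (+ q) f g
      P≡ : P ≡ + (q ℕ.^ suc n)
      P≡ = norm-twist (suc n)
      P-large : 0ℤ ≤ P - + 4 * (+ 64 * + 64) * (+ q * + q * + q * + q)
      P-large = subst (λ P → 0ℤ ≤ P - + 4 * (+ 64 * + 64) * (+ q * + q * + q * + q)) (sym P≡) (power-large (suc n) 18≤n)
      P>0 : 0ℤ < P
      P>0 = subst (0ℤ <_) (sym P≡) (+<+ (ℕ.m^n>0 q {{ℕ.>-nonZero (ℕ.≤-trans (s≤s z≤n) q≥2ℕ)}} (suc n)))
      P≥0 = <⇒≤ P>0
      sqV = square-small P (+ q * v) P≥0 (square-V (+ 64) (+ q) P (0≤+ 64) q≥2 P≥0 P-large v (V²≤4Q (+ q) f g q≥2))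
      sqU = square-small P (+ q * u′) P≥0 (square-U (+ 64) (+ q) P (0≤+ 64) q≥2 P≥0 P-large (+ 2 * f + g) (u²≤4P (+ q) f g q≥2))

    parities : ∀ n → 30 ℕ.≤ n → Parities (+ q) (X n) (p * Y n)
    parities (suc n) 30≤n = [ even , odd ]′ (even⊎odd (+ q))
      where
      p-odd = unit-odd unit-p
      even : Even (+ q) → Parities (+ q) (X (suc n)) (p * Y (suc n))
      even q-even = even-q q-even (even-∣ q-even (q∣X n)) (odd*odd p-odd ([ (λ h → contradiction h Y-not-even) , (λ h → h) ]′ (even⊎odd (Y (suc n)))))
        where
        Y-not-even : ¬ Even (Y (suc n))
        Y-not-even h = let (k , eq) = *-even (Y (suc n)) h ; (l , eq′) = even-∣ q-even (q∣Y²-1 n) in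
          odd≢even l k (trans (trans (cong (λ z → + 1 + z) (sym eq′)) (lem (Y (suc n) * Y (suc n)))) eq)
          where
          lem : ∀ x → + 1 + (x - + 1) ≡ x
          lem = solve-∀
      odd : Odd (+ q) → Parities (+ q) (X (suc n)) (p * Y (suc n))
      odd q-odd = choose (power-parity q-odd (suc n))
        where
        choose : PowerParity (suc n) → Parities (+ q) (X (suc n)) (p * Y (suc n))
        -- Here the exponent `w - 1` is `3k`, and `w - 1 ≥ 30` supplies `k ≥ 10`.
        choose (residue₀ k eq x y) = odd-even q-odd x (*-even p y) (subst (λ n → 32 ℕ.≤ ∣ trace n ∣) (sym eq)
          (trace-large k (ℕ.*-cancelʳ-≤ 10 k 3 (subst (30 ℕ.≤_) eq 30≤n))))
        choose (residue₁ k eq x y) = even-odd q-odd x (odd*odd p-odd y)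
        choose (residue₂ k eq x y) = odd-odd q-odd x (odd*odd p-odd y)

    power-core : ∀ n → 30 ℕ.≤ n → Core (+ q) (X n) (p * Y n)
    power-core n h = core-exists (reduced n (ℕ.≤-trans (ℕ.≤ᵇ⇒≤ 18 30 _) h)) (parities n h)

  -- Points of the open Voronoi cell are digits

  -- Integrality enters the Voronoi argument only here: it lets the linear terms be absorbed by the
  -- quadratic form.
  pred-product : ∀ m → 0ℤ ≤ m * m - m
  pred-product (+ 0) = 0≤+ 0
  pred-product +[1+ n ] = subst (0ℤ ≤_) (lem (+ n)) (_⊠_ {+ suc n} {+ n} (0≤+ _) (0≤+ _))
    where
    lem : ∀ x → (+ 1 + x) * x ≡ (+ 1 + x) * (+ 1 + x) - (+ 1 + x)
    lem = solve-∀
  pred-product m@(-[1+ n ]) = square≥0 m ⊞ 0≤+ (suc n)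

  module _ (q Q : ℤ) (q≥2 : 0ℤ ≤ q - + 2) (Q>0 : 0ℤ < Q) where

    private
      Q≥0 = <⇒≤ Q>0
      q≥0 = <⇒≤ (positive-from-2 q q≥2)

      same-sign : ∀ A B → Inside q Q A B → ∀ m n → 0ℤ ≤ m → 0ℤ ≤ n → 0ℤ < m ⊎ 0ℤ < n → 0ℤ < m * A + n * B + Q * (m * m + m * n + q * (n * n))
      same-sign A B (hexagon _ a _ b _ _) m n m≥0 n≥0 = [ first , second ]′
        where
        rest = Q≥0 ⊠ (pred-product m ⊞ m≥0 ⊠ n≥0 ⊞ q≥0 ⊠ pred-product n)
        first : 0ℤ < m → 0ℤ < m * A + n * B + Q * (m * m + m * n + q * (n * n))
        first m>0 = by< 1 (m>0 ⊠⁺ a ⊞⁺ n≥0 ⊠ <⇒≤ b ⊞ rest) (solve (q ∷ Q ∷ A ∷ B ∷ m ∷ n ∷ []))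
        second : 0ℤ < n → 0ℤ < m * A + n * B + Q * (m * m + m * n + q * (n * n))
        second n>0 = by< 1 (n>0 ⊠⁺ b ⊞⁺ m≥0 ⊠ <⇒≤ a ⊞ rest) (solve (q ∷ Q ∷ A ∷ B ∷ m ∷ n ∷ []))

      -- The vector `(m, -n)` is `n(1, -1) + (m - n)(1, 0)` or `m(1, -1) + (n - m)(0, -1)`, a
      -- nonnegative combination of two adjacent Voronoi neighbours whose inequalities are at hand.
      opposite-sign : ∀ A B → Inside q Q A B → ∀ m n → 0ℤ < m → 0ℤ < n → 0ℤ < m * A + - n * B + Q * (m * m + m * - n + q * (- n * - n))
      opposite-sign A B (hexagon _ a b _ c _) m n m>0 n>0 = choose (compare n m)
        where
        m≥0 = <⇒≤ m>0
        large-m : 0ℤ ≤ m - n → 0ℤ < m * A + - n * B + Q * (m * m + m * - n + q * (- n * - n))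
        large-m e = by< 1 (n>0 ⊠⁺ c ⊞⁺ e ⊠ <⇒≤ a ⊞ Q≥0 ⊠ (pred-product (m - n) ⊞ <⇒≤ n>0 ⊠ e ⊞ q≥0 ⊠ pred-product n))
          (solve (q ∷ Q ∷ A ∷ B ∷ m ∷ n ∷ []))
        large-n : 0ℤ < n - m → 0ℤ < m * A + - n * B + Q * (m * m + m * - n + q * (- n * - n))
        large-n e = by< 1 (m>0 ⊠⁺ c ⊞⁺ <⇒≤ e ⊠ <⇒≤ b ⊞ Q≥0 ⊠ (q≥0 ⊠ pred-product m ⊞ (2 · q≥2 ⊞ 0≤+ 3) ⊠ m≥0 ⊠ <⇒≤ e ⊞ q≥0 ⊠ pred-product (n - m)))
          (solve (q ∷ Q ∷ A ∷ B ∷ m ∷ n ∷ []))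
        choose : 0ℤ < n - m ⊎ 0ℤ < m - n ⊎ n ≡ m → 0ℤ < m * A + - n * B + Q * (m * m + m * - n + q * (- n * - n))
        choose (inj₁ e) = large-n e
        choose (inj₂ (inj₁ e)) = large-m (<⇒≤ e)
        choose (inj₂ (inj₂ n≡m)) = large-m (i≤j⇒0≤j-i (≤-reflexive n≡m))

      0<suc : ∀ n → 0ℤ < +[1+ n ]
      0<suc n = +<+ (s≤s z≤n)

      flip-form : ∀ A B k l → - k * - A + - l * - B + Q * (- k * - k + - k * - l + q * (- l * - l)) ≡ k * A + l * B + Q * (k * k + k * l + q * (l * l))
      flip-form A B k l = solve (q ∷ Q ∷ A ∷ B ∷ k ∷ l ∷ [])

    -- The expression is `|z + ω(k + lτ)|² - |z|²`, so the six inequalities of the hexagon control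
    -- all lattice points.
    Inside-minimal : ∀ A B → Inside q Q A B → ∀ k l → (k , l) ≢ zeroτ →
      0ℤ < k * A + l * B + Q * (k * k + k * l + q * (l * l))
    Inside-minimal A B i (+ 0) (+ 0) h = contradiction refl h
    Inside-minimal A B i (+[1+ m ]) (+ n) _ = same-sign A B i +[1+ m ] (+ n) (0≤+ _) (0≤+ _) (inj₁ (0<suc m))
    Inside-minimal A B i (+ 0) (+[1+ n ]) _ = same-sign A B i (+ 0) +[1+ n ] (0≤+ _) (0≤+ _) (inj₂ (0<suc n))
    Inside-minimal A B i (+[1+ m ]) (-[1+ n ]) _ = opposite-sign A B i +[1+ m ] +[1+ n ] (0<suc m) (0<suc n)
    Inside-minimal A B i (+ 0) (-[1+ n ]) _ = subst (0ℤ <_) (flip-form A B (+ 0) -[1+ n ])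
      (same-sign (- A) (- B) (Inside-neg q Q A B i refl refl) (+ 0) +[1+ n ] (0≤+ _) (0≤+ _) (inj₂ (0<suc n)))
    Inside-minimal A B i (-[1+ m ]) (-[1+ n ]) _ = subst (0ℤ <_) (flip-form A B -[1+ m ] -[1+ n ])
      (same-sign (- A) (- B) (Inside-neg q Q A B i refl refl) +[1+ m ] +[1+ n ] (0≤+ _) (0≤+ _) (inj₁ (0<suc m)))
    Inside-minimal A B i (-[1+ m ]) (+ 0) _ = subst (0ℤ <_) (flip-form A B -[1+ m ] (+ 0))
      (same-sign (- A) (- B) (Inside-neg q Q A B i refl refl) +[1+ m ] (+ 0) (0≤+ _) (0≤+ _) (inj₁ (0<suc m)))
    Inside-minimal A B i (-[1+ m ]) (+[1+ n ]) _ = subst (0ℤ <_) (flip-form A B -[1+ m ] +[1+ n ])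
      (opposite-sign (- A) (- B) (Inside-neg q Q A B i refl refl) +[1+ m ] +[1+ n ] (0<suc m) (0<suc n))

  twist-involutive : ∀ {p} → Unit p → ∀ z → twist p (twist p z) ≡ z
  twist-involutive u (a , b) = cong (a ,_) (lem u b)
    where
    lem : ∀ {p} → Unit p → ∀ b → p * (p * b) ≡ b
    lem (inj₁ refl) = solve-∀
    lem (inj₂ refl) = solve-∀

  -- This is `|z + ωk|² = |z|² + Tr (z ω̄ k̄) + |ω|²|k|²`. In the basis `1,
  -- pτ` the lattice generator is `pω`, so `ωk` is written as `pω · pk`, and `pk` has coordinates `p
  -- * proj₁ k` and `proj₂ k`.
  norm-translate : ∀ {p} → Unit p → ∀ q t z k → let (f , g) = twist p t ; (k₁ , k₂) = twist p k in
    normτ p q (addτ z (mulτ p q (mulτ p q tauτ t) k))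
      ≡ normτ p q z + (p * proj₁ k * lineA q f g (twist p z) + proj₂ k * lineB q f g (twist p z)
        + q * N₁ q f g * (p * proj₁ k * (p * proj₁ k) + p * proj₁ k * proj₂ k + q * (proj₂ k * proj₂ k)))
  norm-translate u q (x , y) (a , b) (k , l) = lem u q x y a b k l
    where
    translateᴱ : ∀ {n} (p q x y a b k l : Expr ℤ n) → Expr ℤ n × Expr ℤ n
    translateᴱ p q x y a b k l = normᴱ p q (addᴱ (a , b) (mulᴱ p q (mulᴱ p q tauᴱ (x , y)) (k , l)))
      , normᴱ p q (a , b) ⊕ (p ⊗ k ⊗ lineAᴱ q x (p ⊗ y) (a , p ⊗ b) ⊕ l ⊗ lineBᴱ q x (p ⊗ y) (a , p ⊗ b)
        ⊕ q ⊗ normᴱ 1ᴱ q (x , p ⊗ y) ⊗ (p ⊗ k ⊗ (p ⊗ k) ⊕ p ⊗ k ⊗ l ⊕ q ⊗ (l ⊗ l)))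
    lem : ∀ {p} → Unit p → ∀ q x y a b k l → let z = (a , p * b) ; g = p * y in
      normτ p q (addτ (a , b) (mulτ p q (mulτ p q tauτ (x , y)) (k , l)))
      ≡ normτ p q (a , b) + (p * k * lineA q x g z + l * lineB q x g z
        + q * N₁ q x g * (p * k * (p * k) + p * k * l + q * (l * l)))
    lem (inj₁ refl) = NR.solve 7 (translateᴱ 1ᴱ) refl
    lem (inj₂ refl) = NR.solve 7 (translateᴱ -1ᴱ) refl

  mul-zeroʳ : ∀ p q x → mulτ p q x zeroτ ≡ zeroτ
  mul-zeroʳ p q (a , b) = cong₂ _,_ (lem₁ q a b) (lem₂ p a b)
    where
    lem₁ : ∀ q a b → a * + 0 - q * (b * + 0) ≡ + 0
    lem₁ = solve-∀
    lem₂ : ∀ p a b → a * + 0 + b * + 0 + p * (b * + 0) ≡ + 0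
    lem₂ = solve-∀

  module Digits {p q : ℤ} (unit-p : Unit p) (q≥2 : 0ℤ ≤ q - + 2) {n : ℕ} {D : Zτ → Set}
    (isD : IsMinNormDigitSet p q (suc n) D)
    (P>0 : 0ℤ < N₁ q (proj₁ (powτ p q tauτ n)) (p * proj₂ (powτ p q tauτ n))) where

    private
      t = powτ p q tauτ n
      f = proj₁ t
      g = p * proj₂ t

    open IsMinNormDigitSet isD

    -- `D` contains some minimal representative of the class; a point of the open cell is the only
    -- minimal element of its class, so the two agree.
    digit : ∀ z → Good q f g z → D (twist p z)
    digit z′ (good inside τ∤) = subst D d≡z Dd
      where
      z = twist p z′
      τ∤z : ¬ Dividesτ p q tauτ z
      τ∤z ((k , l) , eq) = τ∤ (divides (- l) (trans (cong proj₁ eq) (lem q k l)))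
        where
        lem : ∀ q k l → + 0 * k - q * (+ 1 * l) ≡ - l * q
        lem = solve-∀
      rep = represent z τ∤z
      d = proj₁ rep
      Dd = proj₁ (proj₂ rep)
      k = proj₁ (proj₁ (proj₂ (proj₂ rep)))
      d-z : subτ d z ≡ mulτ p q (powτ p q tauτ (suc n)) k
      d-z = proj₂ (proj₁ (proj₂ (proj₂ rep)))
      d-eq : d ≡ addτ z (mulτ p q (powτ p q tauτ (suc n)) k)
      d-eq = trans (cong₂ _,_ (lem (proj₁ d) (proj₁ z)) (lem (proj₂ d) (proj₂ z))) (cong (addτ z) d-z)
        where
        lem : ∀ x y → x ≡ y + (x - y)
        lem = solve-∀
      minimal : normτ p q d ≤ normτ p q z
      minimal = proj₂ (proj₂ (proj₂ rep)) z (zeroτ , trans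
        (cong₂ _,_ (+-inverseʳ (proj₁ z)) (+-inverseʳ (proj₂ z))) (sym (mul-zeroʳ p q (powτ p q tauτ (suc n)))))
      A = lineA q f g z′
      B = lineB q f g z′
      k₁ = p * proj₁ k
      k₂ = proj₂ k
      excess = k₁ * A + k₂ * B + q * N₁ q f g * (k₁ * k₁ + k₁ * k₂ + q * (k₂ * k₂))
      norm-d : normτ p q d ≡ normτ p q z + excess
      norm-d = trans (cong (normτ p q) d-eq) (trans (norm-translate unit-p q t z k)
        (cong (λ z″ → normτ p q z + (k₁ * lineA q f g z″ + k₂ * lineB q f g z″ + q * N₁ q f g * (k₁ * k₁ + k₁ * k₂ + q * (k₂ * k₂))))
          (twist-involutive unit-p z′)))
      k≡0 : (k₁ , k₂) ≡ zeroτ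
      k≡0 = decide (k₁ ≟ 0ℤ) (k₂ ≟ 0ℤ)
        where
        absurd : (k₁ , k₂) ≢ zeroτ → (k₁ , k₂) ≡ zeroτ
        absurd h = contradiction minimal (<⇒≱ (subst₂ _<_ (+-identityʳ (normτ p q z)) (sym norm-d)
          (+-monoʳ-< (normτ p q z) (Inside-minimal q (q * N₁ q f g) q≥2 (positive-from-2 q q≥2 ⊠⁺ P>0) A B inside k₁ k₂ h))))
        decide : Dec (k₁ ≡ 0ℤ) → Dec (k₂ ≡ 0ℤ) → (k₁ , k₂) ≡ zeroτ
        decide (yes h) (yes h′) = cong₂ _,_ h h′
        decide (no h) _ = absurd (h ∘ cong proj₁)
        decide _ (no h) = absurd (h ∘ cong proj₂)
      d≡z : d ≡ z
      d≡z = trans d-eq (cong₂ _,_ (trans (cong (λ y → proj₁ z + proj₁ y) ωk≡0) (+-identityʳ (proj₁ z)))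
        (trans (cong (λ y → proj₂ z + proj₂ y) ωk≡0) (+-identityʳ (proj₂ z))))
        where
        pk : p * proj₁ k ≡ 0ℤ → proj₁ k ≡ 0ℤ
        pk = cancel unit-p (proj₁ k)
          where
          cancel : ∀ {p} → Unit p → ∀ x → p * x ≡ 0ℤ → x ≡ 0ℤ
          cancel (inj₁ refl) x h = trans (sym (*-identityˡ x)) h
          cancel (inj₂ refl) x h = trans (sym (neg-involutive x)) (cong -_ (trans (sym (-1*i≡-i x)) h))
        k-zero : k ≡ zeroτ
        k-zero = cong₂ _,_ (pk (cong proj₁ k≡0)) (cong proj₂ k≡0)
        ωk≡0 : mulτ p q (powτ p q tauτ (suc n)) k ≡ zeroτ
        ωk≡0 = trans (cong (mulτ p q (powτ p q tauτ (suc n))) k-zero) (mul-zeroʳ p q (powτ p q tauτ (suc n)))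

  -- Expansions

  gap : ℕ → List Zτ → List Zτ
  gap m s = replicate m zeroτ ++ s

  lookup-gap : ∀ m s (j : Fin (length (gap m s))) → toℕ j ℕ.< m → lookup (gap m s) j ≡ zeroτ
  lookup-gap (suc m) s zero _ = refl
  lookup-gap (suc m) s (suc j) (s≤s h) = lookup-gap m s j h

  wnaf-digit : ∀ {w s} x → IsWNAF w s → (∀ j → suc (toℕ j) ℕ.< w → lookup s j ≡ zeroτ) → IsWNAF w (x ∷ s)
  wnaf-digit x h k zero (suc j) _ j<w _ j≢0 = j≢0 (k j j<w)
  wnaf-digit x h k (suc i) (suc j) (s≤s i<j) (s≤s j<i+w) = h i j i<j j<i+w

  wnaf-gap : ∀ {w s} m → IsWNAF w s → IsWNAF w (gap m s)
  wnaf-gap zero h = h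
  wnaf-gap (suc m) h zero (suc j) _ _ i≢0 _ = i≢0 refl
  wnaf-gap (suc m) h (suc i) (suc j) (s≤s i<j) (s≤s j<i+w) = wnaf-gap m h i j i<j j<i+w

  wnaf-spaced : ∀ {m s} x → IsWNAF (suc m) s → IsWNAF (suc m) (x ∷ gap m s)
  wnaf-spaced {m} {s} x h = wnaf-digit x (wnaf-gap m h) (λ { j (s≤s j<m) → lookup-gap m s j j<m })

  allIn-∷ : ∀ {D x s} → D x → AllIn D s → AllIn D (x ∷ s)
  allIn-∷ dx h zero = dx
  allIn-∷ dx h (suc i) = h i

  allIn-gap : ∀ {D s} m → D zeroτ → AllIn D s → AllIn D (gap m s)
  allIn-gap zero d0 h = h
  allIn-gap {D} (suc m) d0 h = allIn-∷ {D} d0 (allIn-gap {D} m d0 h)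

  weight-gap : ∀ m s → weight (gap m s) ≡ weight s
  weight-gap zero s = refl
  weight-gap (suc m) s = weight-gap m s

  weight-nonzero : ∀ x s → proj₁ x ≢ + 0 → weight (x ∷ s) ≡ suc (weight s)
  weight-nonzero (a , b) s a≢0 with a ≟ + 0 | b ≟ + 0
  ... | yes a≡0 | _ = contradiction a≡0 a≢0
  ... | no _ | _ = refl

  weight-spaced : ∀ m x s → proj₁ x ≢ + 0 → weight (x ∷ gap m s) ≡ suc (weight s)
  weight-spaced m x s h = trans (weight-nonzero x (gap m s) h) (cong suc (weight-gap m s))

  module _ (p q : ℤ) where

    mul-assoc : ∀ x y z → mulτ p q x (mulτ p q y z) ≡ mulτ p q (mulτ p q x y) z
    mul-assoc (a , b) (c , d) (e , f) = cong₂ _,_ (lem₁ p q a b c d e f) (lem₂ p q a b c d e f)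
      where
      lem₁ : ∀ p q a b c d e f → let m = mulτ p q in proj₁ (m (a , b) (m (c , d) (e , f))) ≡ proj₁ (m (m (a , b) (c , d)) (e , f))
      lem₁ = NR.solve 8 (λ p q a b c d e f → let m = mulᴱ p q in proj₁ (m (a , b) (m (c , d) (e , f))) , proj₁ (m (m (a , b) (c , d)) (e , f))) refl
      lem₂ : ∀ p q a b c d e f → let m = mulτ p q in proj₂ (m (a , b) (m (c , d) (e , f))) ≡ proj₂ (m (m (a , b) (c , d)) (e , f))
      lem₂ = NR.solve 8 (λ p q a b c d e f → let m = mulᴱ p q in proj₂ (m (a , b) (m (c , d) (e , f))) , proj₂ (m (m (a , b) (c , d)) (e , f))) refl

    mul-identityˡ : ∀ x → mulτ p q oneτ x ≡ x
    mul-identityˡ (a , b) = cong₂ _,_ (lem₁ q a b) (lem₂ p a b)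
      where
      lem₁ : ∀ q a b → + 1 * a - q * (+ 0 * b) ≡ a
      lem₁ = solve-∀
      lem₂ : ∀ p a b → + 1 * b + + 0 * a + p * (+ 0 * b) ≡ b
      lem₂ = solve-∀

    value-gap : ∀ m s → value p q (gap m s) ≡ mulτ p q (powτ p q tauτ m) (value p q s)
    value-gap zero s = sym (mul-identityˡ (value p q s))
    value-gap (suc m) s = trans (cong₂ _,_ (+-identityˡ _) (+-identityˡ _))
      (trans (cong (mulτ p q tauτ) (value-gap m s)) (mul-assoc tauτ (powτ p q tauτ m) (value p q s)))

    value-spaced : ∀ m x s → value p q (x ∷ gap m s) ≡ addτ x (mulτ p q (powτ p q tauτ (suc m)) (value p q s))
    value-spaced m x s = cong (addτ x) (trans (cong (mulτ p q tauτ) (value-gap m s)) (mul-assoc tauτ (powτ p q tauτ m) (value p q s)))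

    value-single : ∀ x → value p q (x ∷ []) ≡ x
    value-single (a , b) = cong₂ _,_ (lem₁ q a) (lem₂ p b)
      where
      lem₁ : ∀ q a → a + (+ 0 * + 0 - q * (+ 1 * + 0)) ≡ a
      lem₁ = solve-∀
      lem₂ : ∀ p b → b + (+ 0 * + 0 + + 1 * + 0 + p * (+ 1 * + 0)) ≡ b
      lem₂ = solve-∀

    mul-identityʳ : ∀ x → mulτ p q x oneτ ≡ x
    mul-identityʳ (a , b) = cong₂ _,_ (lem₁ q a b) (lem₂ p a b)
      where
      lem₁ : ∀ q a b → a * + 1 - q * (b * + 0) ≡ a
      lem₁ = solve-∀
      lem₂ : ∀ p a b → a * + 0 + b * + 1 + p * (b * + 0) ≡ b
      lem₂ = solve-∀

  twist-low : ∀ {p} → Unit p → ∀ q t x y →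
    twist p (addτ x (mulτ (+ 1) q (twist p t) y)) ≡ addτ (twist p x) (mulτ p q t (twist p y))
  twist-low u q (f , g) (a , b) (c , d) = cong₂ _,_ (lem₁ u q f g a c d) (lem₂ u q f g b c d)
    where
    lem₁ : ∀ {p} → Unit p → ∀ q f g a c d → a + proj₁ (mulτ (+ 1) q (f , p * g) (c , d)) ≡ a + proj₁ (mulτ p q (f , g) (c , p * d))
    lem₁ (inj₁ refl) = NR.solve 6 (λ q f g a c d → let p = 1ᴱ in a ⊕ proj₁ (mulᴱ 1ᴱ q (f , p ⊗ g) (c , d)) , a ⊕ proj₁ (mulᴱ p q (f , g) (c , p ⊗ d))) refl
    lem₁ (inj₂ refl) = NR.solve 6 (λ q f g a c d → let p = -1ᴱ in a ⊕ proj₁ (mulᴱ 1ᴱ q (f , p ⊗ g) (c , d)) , a ⊕ proj₁ (mulᴱ p q (f , g) (c , p ⊗ d))) refl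
    lem₂ : ∀ {p} → Unit p → ∀ q f g b c d → p * (b + proj₂ (mulτ (+ 1) q (f , p * g) (c , d))) ≡ p * b + proj₂ (mulτ p q (f , g) (c , p * d))
    lem₂ (inj₁ refl) = NR.solve 6 (λ q f g b c d → let p = 1ᴱ in p ⊗ (b ⊕ proj₂ (mulᴱ 1ᴱ q (f , p ⊗ g) (c , d))) , p ⊗ b ⊕ proj₂ (mulᴱ p q (f , g) (c , p ⊗ d))) refl
    lem₂ (inj₂ refl) = NR.solve 6 (λ q f g b c d → let p = -1ᴱ in p ⊗ (b ⊕ proj₂ (mulᴱ 1ᴱ q (f , p ⊗ g) (c , d))) , p ⊗ b ⊕ proj₂ (mulᴱ p q (f , g) (c , p ⊗ d))) refl

  mul-unit : ∀ {p} → Unit p → Zτ → Zτ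
  mul-unit (inj₁ _) r = r
  mul-unit (inj₂ _) r = negτ r

  -- The twist of ω′ is pω; the factor p is absorbed by the middle digit.
  twist-high : ∀ {p} (u : Unit p) → ∀ q t x r → let ω′ = mulτ (+ 1) q tauτ (twist p t) ; ω = mulτ p q tauτ t in
    twist p (addτ x (mulτ (+ 1) q ω′ (addτ r ω′))) ≡ addτ (twist p x) (mulτ p q ω (addτ (twist p (mul-unit u r)) ω))
  twist-high (inj₁ refl) q (f , g) (a , b) (c , d) = cong₂ _,_ (lem₁ q f g a c d) (lem₂ q f g b c d)
    where
    lem₁ : ∀ q f g a c d → let ω′ = mulτ (+ 1) q tauτ (f , + 1 * g) ; ω = mulτ (+ 1) q tauτ (f , g) in
      a + proj₁ (mulτ (+ 1) q ω′ (addτ (c , d) ω′)) ≡ a + proj₁ (mulτ (+ 1) q ω (addτ (c , + 1 * d) ω))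
    lem₁ = NR.solve 6 (λ q f g a c d → let ω′ = mulᴱ 1ᴱ q tauᴱ (f , 1ᴱ ⊗ g) ; ω = mulᴱ 1ᴱ q tauᴱ (f , g) in
      a ⊕ proj₁ (mulᴱ 1ᴱ q ω′ (addᴱ (c , d) ω′)) , a ⊕ proj₁ (mulᴱ 1ᴱ q ω (addᴱ (c , 1ᴱ ⊗ d) ω))) refl
    lem₂ : ∀ q f g b c d → let ω′ = mulτ (+ 1) q tauτ (f , + 1 * g) ; ω = mulτ (+ 1) q tauτ (f , g) in
      + 1 * (b + proj₂ (mulτ (+ 1) q ω′ (addτ (c , d) ω′))) ≡ + 1 * b + proj₂ (mulτ (+ 1) q ω (addτ (c , + 1 * d) ω))
    lem₂ = NR.solve 6 (λ q f g b c d → let ω′ = mulᴱ 1ᴱ q tauᴱ (f , 1ᴱ ⊗ g) ; ω = mulᴱ 1ᴱ q tauᴱ (f , g) in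
      1ᴱ ⊗ (b ⊕ proj₂ (mulᴱ 1ᴱ q ω′ (addᴱ (c , d) ω′))) , 1ᴱ ⊗ b ⊕ proj₂ (mulᴱ 1ᴱ q ω (addᴱ (c , 1ᴱ ⊗ d) ω))) refl
  twist-high (inj₂ refl) q (f , g) (a , b) (c , d) = cong₂ _,_ (lem₁ q f g a c d) (lem₂ q f g b c d)
    where
    lem₁ : ∀ q f g a c d → let ω′ = mulτ (+ 1) q tauτ (f , -1ℤ * g) ; ω = mulτ -1ℤ q tauτ (f , g) in
      a + proj₁ (mulτ (+ 1) q ω′ (addτ (c , d) ω′)) ≡ a + proj₁ (mulτ -1ℤ q ω (addτ (- c , -1ℤ * - d) ω))
    lem₁ = NR.solve 6 (λ q f g a c d → let ω′ = mulᴱ 1ᴱ q tauᴱ (f , -1ᴱ ⊗ g) ; ω = mulᴱ -1ᴱ q tauᴱ (f , g) in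
      a ⊕ proj₁ (mulᴱ 1ᴱ q ω′ (addᴱ (c , d) ω′)) , a ⊕ proj₁ (mulᴱ -1ᴱ q ω (addᴱ (⊝ c , -1ᴱ ⊗ ⊝ d) ω))) refl
    lem₂ : ∀ q f g b c d → let ω′ = mulτ (+ 1) q tauτ (f , -1ℤ * g) ; ω = mulτ -1ℤ q tauτ (f , g) in
      -1ℤ * (b + proj₂ (mulτ (+ 1) q ω′ (addτ (c , d) ω′))) ≡ -1ℤ * b + proj₂ (mulτ -1ℤ q ω (addτ (- c , -1ℤ * - d) ω))
    lem₂ = NR.solve 6 (λ q f g b c d → let ω′ = mulᴱ 1ᴱ q tauᴱ (f , -1ᴱ ⊗ g) ; ω = mulᴱ -1ᴱ q tauᴱ (f , g) in
      -1ᴱ ⊗ (b ⊕ proj₂ (mulᴱ 1ᴱ q ω′ (addᴱ (c , d) ω′))) , -1ᴱ ⊗ b ⊕ proj₂ (mulᴱ -1ᴱ q ω (addᴱ (⊝ c , -1ᴱ ⊗ ⊝ d) ω))) refl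

  -- The leading digit of the w-NAF of weight 3 is 1, which is tiny compared with the cell.
  Good-one : ∀ {q f g} → Reduced q f g → Good q f g oneτ
  Good-one {q} {f} {g} red = good
    (widen q P (lineA q f g oneτ) (lineB q f g oneτ) q≥2 (<⇒≤ P>0)
      (Hexagon-small P (V q f g) (U q f g) (q * V q f g) (+ 1) (+ 0) P>0 sV sU sqV (0≤+ 3) (0≤+ 1) (0≤+ 2) (0≤+ 2)))
    (∤1 q≥2)
    where
    open Reduced red
    P = N₁ q f g
    widen : ∀ q P A B → 0ℤ ≤ q - + 2 → 0ℤ ≤ P → Hexagon _<_ P P A B → Inside q (q * P) A B
    widen q P A B t P≥0 (hexagon a a′ b b′ c c′) = hexagon
      (by< 1 (a ⊞⁺ h) (solve (q ∷ P ∷ A ∷ B ∷ []))) (by< 1 (a′ ⊞⁺ h) (solve (q ∷ P ∷ A ∷ B ∷ [])))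
      (by< 1 (b ⊞⁺ k) (solve (q ∷ P ∷ A ∷ B ∷ []))) (by< 1 (b′ ⊞⁺ k) (solve (q ∷ P ∷ A ∷ B ∷ [])))
      (by< 1 (c ⊞⁺ k) (solve (q ∷ P ∷ A ∷ B ∷ []))) (by< 1 (c′ ⊞⁺ k) (solve (q ∷ P ∷ A ∷ B ∷ [])))
      where
      h = t ⊠ P≥0 ⊞ P≥0
      k = t ⊠ t ⊠ P≥0 ⊞ 4 · (t ⊠ P≥0) ⊞ 3 · P≥0

  Good-unit : ∀ {p q f g} (u : Unit p) r → Good q f g r → Good q f g (mul-unit u r)
  Good-unit (inj₁ _) r h = h
  Good-unit (inj₂ _) r h = Good-neg r h

  twist-one : ∀ {p} → Unit p → twist p oneτ ≡ oneτ
  twist-one (inj₁ refl) = refl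
  twist-one (inj₂ refl) = refl

  not-optimal : ∀ q → 2 ℕ.≤ q → ∀ p → Unit p → ∀ w → 31 ℕ.≤ w → WNAFNotOptimal p (+ q) w
  not-optimal q 2≤q p u (suc n@(suc m)) (s≤s 30≤n) D isD optimal = ℕ.1+n≰n (subst₂ ℕ._≤_ weight-s weight-t
    (optimal s t s∈D s-wnaf t∈D (trans value-s (sym value-t))))
    where
    q≥2 : 0ℤ ≤ + q - + 2
    q≥2 = i≤j⇒0≤j-i (+≤+ 2≤q)
    open Powers q q≥2 p u
    red = reduced n (ℕ.≤-trans (ℕ.≤ᵇ⇒≤ 18 30 _) 30≤n)
    open Core (power-core n 30≤n)
    open Digits u q≥2 isD (Reduced.P>0 red)
    open IsMinNormDigitSet isD using (zero∈D)

    r′ = mul-unit u r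
    good-r′ = Good-unit u r good-r

    s t : List Zτ
    -- As `n = w - 1` and `m = w - 2`, the digits of `s` stand at positions `0`, `w`, `2w`, and
    -- those of `t` at `0` and `w - 1`, one place too close for a w-NAF.
    s = twist p c ∷ gap n (twist p r′ ∷ gap n (oneτ ∷ []))
    t = twist p d₁ ∷ gap m (twist p d₂ ∷ [])

    D-one : D oneτ
    D-one = subst D (twist-one u) (digit oneτ (Good-one red))

    nonzero : ∀ {z} → Good (+ q) (X n) (p * Y n) z → proj₁ z ≢ + 0
    nonzero h eq = Good.τ∤ h (divides (+ 0) eq)

    s∈D : AllIn D s
    s∈D = allIn-∷ {D} (digit c good-c) (allIn-gap {D} n zero∈D
      (allIn-∷ {D} (digit r′ good-r′) (allIn-gap {D} n zero∈D (allIn-∷ {D} D-one (λ ())))))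

    t∈D : AllIn D t
    t∈D = allIn-∷ {D} (digit d₁ good-d₁) (allIn-gap {D} m zero∈D (allIn-∷ {D} (digit d₂ good-d₂) (λ ())))

    s-wnaf : IsWNAF (suc n) s
    s-wnaf = wnaf-spaced (twist p c) (wnaf-spaced (twist p r′) (wnaf-digit {s = []} oneτ (λ ()) (λ ())))

    weight-s : weight s ≡ 3
    weight-s = trans (weight-spaced n (twist p c) (twist p r′ ∷ gap n (oneτ ∷ [])) (nonzero good-c)) (cong suc (weight-spaced n (twist p r′) (oneτ ∷ []) (nonzero good-r′)))

    weight-t : weight t ≡ 2
    weight-t = trans (weight-spaced m (twist p d₁) (twist p d₂ ∷ []) (nonzero good-d₁)) (cong suc (weight-nonzero (twist p d₂) [] (nonzero good-d₂)))

    ω = powτ p (+ q) tauτ (suc n)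

    value-s : value p (+ q) s ≡ addτ (twist p c) (mulτ p (+ q) ω (addτ (twist p r′) ω))
    value-s = trans (value-spaced p (+ q) n (twist p c) (twist p r′ ∷ gap n (oneτ ∷ []))) (cong (λ z → addτ (twist p c) (mulτ p (+ q) ω z))
      (trans (value-spaced p (+ q) n (twist p r′) (oneτ ∷ [])) (cong (addτ (twist p r′))
        (trans (cong (mulτ p (+ q) ω) (value-single p (+ q) oneτ)) (mul-identityʳ p (+ q) ω)))))

    value-t : value p (+ q) t ≡ addτ (twist p c) (mulτ p (+ q) ω (addτ (twist p r′) ω))
    value-t = trans (value-spaced p (+ q) m (twist p d₁) (twist p d₂ ∷ [])) (trans (cong (λ z → addτ (twist p d₁) (mulτ p (+ q) (τ^ n) z)) (value-single p (+ q) (twist p d₂)))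
      (trans (sym (twist-low u (+ q) (τ^ n) d₁ d₂)) (trans (cong (twist p) carry) (twist-high u (+ q) (τ^ n) c r))))

open NonOptimality using (not-optimal)
open import Data.Nat using (ℕ; zero; suc; s≤s; _≤_)
import Data.Nat as ℕ
import Data.Nat.Properties as ℕ
open import Data.Integer using (ℤ; +_; -1ℤ)
import Data.Integer as ℤ
import Data.Integer.Properties as ℤ
open import Data.Product using (Σ; _×_; _,_)
open import Data.Sum using (_⊎_)
open import Relation.Binary.PropositionalEquality using (_≡_; subst; sym)
open import Data.Rational.Unnormalised using (ℚᵘ; _/_; 1ℚᵘ; 0ℚᵘ)
import Data.Rational.Unnormalised as ℚ
import Data.Rational.Unnormalised.Properties as ℚ
open import Relation.Nullary.Decidable using (from-yes; from-no)

-- Upper bounds for the exponential function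

expTerm-nonNeg : ∀ x .{{_ : ℚ.NonNegative x}} n → ℚ.NonNegative (expTerm x n)
expTerm-nonNeg x zero = _
expTerm-nonNeg x (suc n) = ℚ.nonNeg*nonNeg⇒nonNeg (expTerm x n ℚ.* x) {{ℚ.nonNeg*nonNeg⇒nonNeg (expTerm x n) {{expTerm-nonNeg x n}} x}} (+ 1 / suc n)

-- The tail after expPartial x n is dominated by a geometric series with sum c · expTerm x n.
exp-tail : ∀ x .{{_ : ℚ.NonNegative x}} c n → x ℚ.* (+ 1 / suc n) ℚ.* (1ℚᵘ ℚ.+ c) ℚ.≤ c →
  expPartial x (suc n) ℚ.+ expTerm x (suc n) ℚ.* c ℚ.≤ expPartial x n ℚ.+ expTerm x n ℚ.* c
exp-tail x c n ratio = begin
  S ℚ.+ T′ ℚ.+ T′ ℚ.* c            ≃⟨ ℚ.+-assoc S T′ (T′ ℚ.* c) ⟩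
  S ℚ.+ (T′ ℚ.+ T′ ℚ.* c)          ≃⟨ ℚ.+-congʳ S (ℚ.+-congˡ (T′ ℚ.* c) (ℚ.≃-sym (ℚ.*-identityʳ T′))) ⟩
  S ℚ.+ (T′ ℚ.* 1ℚᵘ ℚ.+ T′ ℚ.* c)  ≃⟨ ℚ.+-congʳ S (ℚ.≃-sym (ℚ.*-distribˡ-+ T′ 1ℚᵘ c)) ⟩
  S ℚ.+ T′ ℚ.* (1ℚᵘ ℚ.+ c)         ≃⟨ ℚ.+-congʳ S (ℚ.*-congʳ (ℚ.*-assoc T x r)) ⟩
  S ℚ.+ T ℚ.* (x ℚ.* r) ℚ.* (1ℚᵘ ℚ.+ c) ≃⟨ ℚ.+-congʳ S (ℚ.*-assoc T (x ℚ.* r) (1ℚᵘ ℚ.+ c)) ⟩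
  S ℚ.+ T ℚ.* (x ℚ.* r ℚ.* (1ℚᵘ ℚ.+ c)) ≤⟨ ℚ.+-monoʳ-≤ S (ℚ.*-monoʳ-≤-nonNeg T {{expTerm-nonNeg x n}} ratio) ⟩
  S ℚ.+ T ℚ.* c                    ∎
  where
  open ℚ.≤-Reasoning
  S = expPartial x n
  T = expTerm x n
  T′ = expTerm x (suc n)
  r = + 1 / suc n

reciprocal-≤ : ∀ m n → m ≤ n → + 1 / suc n ℚ.≤ + 1 / suc m
reciprocal-≤ m n m≤n = ℚ.*≤* (ℤ.*-monoˡ-≤-nonNeg (+ 1) (ℤ.+≤+ (s≤s m≤n)))

exp-ratio : ∀ x .{{_ : ℚ.NonNegative x}} c .{{_ : ℚ.NonNegative (1ℚᵘ ℚ.+ c)}} m → x ℚ.* (+ 1 / suc m) ℚ.* (1ℚᵘ ℚ.+ c) ℚ.≤ c →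
  ∀ n → m ≤ n → x ℚ.* (+ 1 / suc n) ℚ.* (1ℚᵘ ℚ.+ c) ℚ.≤ c
exp-ratio x c m h n m≤n = ℚ.≤-trans (ℚ.*-monoˡ-≤-nonNeg (1ℚᵘ ℚ.+ c) (ℚ.*-monoʳ-≤-nonNeg x (reciprocal-≤ m n m≤n))) h

-- From index `m` on, the quotient of consecutive terms is at most `ρ = x/(m + 1)`. The hypothesis
-- is `ρ(1 + c) ≤ c`, with equality for the geometric sum `c = ρ/(1 - ρ)`.
exp-bound : ∀ x .{{_ : ℚ.NonNegative x}} c .{{_ : ℚ.NonNegative c}} .{{_ : ℚ.NonNegative (1ℚᵘ ℚ.+ c)}} m →
  x ℚ.* (+ 1 / suc m) ℚ.* (1ℚᵘ ℚ.+ c) ℚ.≤ c →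
  ∀ n → expPartial x (n ℕ.+ m) ℚ.≤ expPartial x m ℚ.+ expTerm x m ℚ.* c
exp-bound x c m h n = ℚ.≤-trans
  (ℚ.p≤p+q (expPartial x (n ℕ.+ m)) (expTerm x (n ℕ.+ m) ℚ.* c)
    {{ℚ.nonNeg*nonNeg⇒nonNeg (expTerm x (n ℕ.+ m)) {{expTerm-nonNeg x (n ℕ.+ m)}} c}})
  (descend n)
  where
  descend : ∀ n → expPartial x (n ℕ.+ m) ℚ.+ expTerm x (n ℕ.+ m) ℚ.* c ℚ.≤ expPartial x m ℚ.+ expTerm x m ℚ.* c
  descend zero = ℚ.≤-refl
  descend (suc n) = ℚ.≤-trans (exp-tail x c (n ℕ.+ m) (exp-ratio x c m h (n ℕ.+ m) (ℕ.m≤n+m m n))) (descend n)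

exp-quarter : ExpLt (+ 1 / 4) (+ 3 / 2)
exp-quarter = + 1 / 6 , from-yes (0ℚᵘ ℚ.<? (+ 1 / 6)) , bound
  where
  bound : ∀ n → expPartial (+ 1 / 4) n ℚ.+ + 1 / 6 ℚ.≤ + 3 / 2
  bound n = ℚ.≤-trans (ℚ.+-monoˡ-≤ (+ 1 / 6) (subst (λ n → expPartial (+ 1 / 4) n ℚ.≤ 1ℚᵘ ℚ.+ 1ℚᵘ ℚ.* (+ 1 / 3)) (ℕ.+-identityʳ n)
      -- `ρ = 1/4` gives `c = 1/3`; the bound 4/3 leaves exactly 1/6 below 3/2.
      (exp-bound (+ 1 / 4) (+ 1 / 3) 0 (from-yes (((+ 1 / 4) ℚ.* (+ 1 / 1) ℚ.* (1ℚᵘ ℚ.+ + 1 / 3)) ℚ.≤? (+ 1 / 3))) n)))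
    (from-yes ((1ℚᵘ ℚ.+ 1ℚᵘ ℚ.* (+ 1 / 3) ℚ.+ + 1 / 6) ℚ.≤? (+ 3 / 2)))

exp-three-halves : ∀ q → 13 ≤ q → ExpLt (+ 3 / 2) (+ q / 1)
exp-three-halves q 13≤q = 1ℚᵘ , from-yes (0ℚᵘ ℚ.<? 1ℚᵘ) , λ n → ℚ.≤-trans (ℚ.+-monoˡ-≤ 1ℚᵘ (bound n)) 8≤q
  where
  8≤q : + 7 / 1 ℚ.+ 1ℚᵘ ℚ.≤ + q / 1
  8≤q = ℚ.*≤* (subst (+ 8 ℤ.≤_) (sym (ℤ.*-identityʳ (+ q))) (ℤ.+≤+ (ℕ.≤-trans (ℕ.≤ᵇ⇒≤ 8 13 _) 13≤q)))
  bound : ∀ n → expPartial (+ 3 / 2) n ℚ.≤ + 7 / 1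
  -- At index 0 the ratio 3/2 exceeds 1, so the geometric tail starts at index 1, where `ρ = 3/4`
  -- and `c = 3`; the bound is `1 + 3/2 + 9/2 = 7`.
  bound zero = from-yes (1ℚᵘ ℚ.≤? (+ 7 / 1))
  bound (suc n) = ℚ.≤-trans (subst (λ n → expPartial (+ 3 / 2) n ℚ.≤ expPartial (+ 3 / 2) 1 ℚ.+ expTerm (+ 3 / 2) 1 ℚ.* (+ 3 / 1)) (ℕ.+-comm n 1)
      (exp-bound (+ 3 / 2) (+ 3 / 1) 1 (from-yes (((+ 3 / 2) ℚ.* (+ 1 / 2) ℚ.* (1ℚᵘ ℚ.+ + 3 / 1)) ℚ.≤? (+ 3 / 1))) n))
    (from-yes ((expPartial (+ 3 / 2) 1 ℚ.+ expTerm (+ 3 / 2) 1 ℚ.* (+ 3 / 1)) ℚ.≤? (+ 7 / 1)))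

-- One pair of rationals is enough: `e^(3/2) < 13 ≤ q` and `e^(1/4) < 3/2`, so `3/2` and `1/4` are
-- admissible, and `3/8` of the constant is far above 31.
logLog⇒large : ∀ q → 13 ≤ q → ∀ w → LogLogBound C-large q (+ w / 1) → 31 ≤ w
logLog⇒large q 13≤q w bound = ℕ.≮⇒≥ (λ w<31 → from-no (Cab ℚ.≤? (+ 31 / 1))
  (ℚ.≤-trans (bound (+ 3 / 2) (+ 1 / 4) (from-yes (0ℚᵘ ℚ.<? (+ 3 / 2))) (from-yes (0ℚᵘ ℚ.<? (+ 1 / 4)))
      (exp-three-halves q 13≤q) exp-quarter)
    (ℚ.*≤* (ℤ.*-monoʳ-≤-nonNeg (+ 1) (ℤ.+≤+ (ℕ.<⇒≤ w<31))))))
  where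
  Cab = C-large ℚ.* ((+ 3 / 2) ℚ.* (+ 1 / 4))

theorem2p3 : ∀ (q : ℕ) → 2 ≤ q → ∀ (p : ℤ) → (p ≡ + 1 ⊎ p ≡ -1ℤ) →
    (Σ ℕ λ wq → ∀ (w : ℕ) → 2 ≤ w → wq ≤ w → WNAFNotOptimal p (+ q) w)
    × (13 ≤ q → ∀ (w : ℕ) → 2 ≤ w → LogLogBound C-large q (+ w / 1) → WNAFNotOptimal p (+ q) w)
    × (q ≤ 12 → ∀ (w : ℕ) → 2 ≤ w → 19730000000000000 ≤ w → WNAFNotOptimal p (+ q) w)
theorem2p3 q 2≤q p unit =
    (31 , λ w _ → not-optimal q 2≤q p unit w)
  , (λ 13≤q w _ bound → not-optimal q 2≤q p unit w (logLog⇒large q 13≤q w bound))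
  , (λ _ w _ large → not-optimal q 2≤q p unit w (ℕ.≤-trans (ℕ.≤ᵇ⇒≤ 31 19730000000000000 _) large))
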